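{- Let $m\ge 3$, $n\ge 2$, let $\mathcal{C}^3_{m,n}=(V_1,V_2,E)$, and let $e\in E$ be a hyperedge containing exactly two vertices of $V_1$ and one vertex of $V_2$. Then the Seidel spectrum of $\mathcal{C}^3_{m,n}-e$ consists of the eigenvalue $2n-1$ with multiplicity $m-3$, the eigenvalue $2m-1$ with multiplicity $n-2$, and the five roots $\tau_1,\dots,\tau_5$ of $\xi_2(\tau)=0$, where \begin{align*} \xi_2(\tau)={}&-\tau^5+(-5+5m+7n-4mn)\tau^4\\ &+(46+4m-8m^2+4n-22mn-6m^2n+4m^3n-18n^2+2mn^2+4m^2n^2+4mn^3)\tau^3\\ &+(286-206m+8m^2+4m^3-234n+62mn-10m^2n+40m^3n-8m^4n-46n^2-10mn^2\\ &\quad+64m^2n^2-24m^3n^2+36n^3+52mn^3-24m^2n^3-16mn^4)\tau^2\\ &+(83-228m-40m^2+40m^3+76n-90mn+246m^2n-28m^3n-16m^4n-366n^2+238mn^2\\ &\quad+132m^2n^2-160m^3n^2+32m^4n^2+248n^3+20mn^3-184m^2n^3+48m^3n^3-40n^4\\ &\quad-88mn^4+48m^2n^4+16mn^5)\tau\\ &+(-921+873m-408m^2+84m^3+2387n-2250mn+1274m^2n-368m^3n+24m^4n-2322n^2\\ &\quad+1994mn^2-680m^2n^2+40m^3n^2+32m^4n^2+1012n^3-732mn^3-160m^2n^3\\ &\quad+160m^3n^3-32m^4n^3-168n^4+72mn^4+160m^2n^4-32m^3n^4+16mn^5-32m^2n^5). \end{align*}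
   Context: For a hypergraph $\mathcal{H}$ and distinct vertices $i,j$, the co-degree $c_{ij}$ is the number of hyperedges containing both $i$ and $j$. The Seidel matrix $\mathcal{S}(\mathcal{H})$ has zero diagonal and $(i,j)$-entry $1-2c_{ij}$ for $i\neq j$; its eigenvalues (with multiplicity) form the Seidel spectrum of $\mathcal{H}$. The complete $3$-uniform bipartite hypergraph $\mathcal{C}^3_{m,n}=(V_1,V_2,E)$ has vertex set $V_1\sqcup V_2$, $|V_1|=m$, $|V_2|=n$, and $E$ = all $3$-subsets meeting both $V_1$ and $V_2$. For a hyperedge $e$, $\mathcal{H}-e$ denotes the hypergraph with the same vertex set and hyperedge set $E\setminus\{e\}$. -}

module Defs where

open import Level using (Level; _⊔_)
open import Algebra.Bundles using (RawRing; CommutativeRing)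
import Algebra.Definitions.RawMonoid as RawMonoidDefs
import Algebra.Definitions.RawSemiring as RawSemiringDefs
open import Agda.Builtin.FromNat using (Number; fromNat)
import Data.Bool as Bool
open import Data.Fin as Fin using (Fin; zero; suc; toℕ; punchIn)
open import Data.Fin.Subset
  using (Subset; inside; outside; _∩_; ∣_∣; Nonempty; ⊤; ⊥)
open import Data.Fin.Subset.Properties using (_∈?_; nonempty?)
open import Data.Integer using (ℤ; +_; -[1+_]; _+_; _-_; _*_; -_; _^_)
import Data.Integer.Literals as ℤLiterals
open import Data.List using (List; []; _∷_; _++_; map; filter; length; foldr)
import Data.Nat as ℕ
open ℕ using (ℕ)
import Data.Nat.Literals as ℕLiterals
open import Data.Product using (_×_; ∃)
open import Data.Sum using (_⊎_)
open import Data.Unit using (tt)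
import Data.Vec as Vec
import Data.Vec.Properties as Vecₚ
open import Relation.Binary.PropositionalEquality using (_≡_)
open import Relation.Nullary using (¬_; yes; no)
open import Relation.Nullary.Decidable using (_×-dec_; ¬?)
open import Relation.Unary using (Decidable)

private
  variable
    a c ℓ : Level
    N : ℕ

  instance
    natLiteral : Number ℕ
    natLiteral = ℕLiterals.number

    intLiteral : Number ℤ
    intLiteral = ℤLiterals.number

record Hypergraph (N : ℕ) : Set₁ where
  field
    IsEdge  : Subset N → Set
    isEdge? : Decidable IsEdge

open Hypergraph public

subsets : ∀ N → List (Subset N)
subsets ℕ.zero    = Vec.[] ∷ []
subsets (ℕ.suc N) = map (inside Vec.∷_) (subsets N) ++ map (outside Vec.∷_) (subsets N)

codegree : Hypergraph N → Fin N → Fin N → ℕ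
codegree {N} H i j =
  length (filter (λ e → isEdge? H e ×-dec (i ∈? e) ×-dec (j ∈? e)) (subsets N))

infixl 6 _∖ᵉ_
_∖ᵉ_ : Hypergraph N → Subset N → Hypergraph N
(H ∖ᵉ e) .IsEdge f  = IsEdge H f × ¬ f ≡ e
(H ∖ᵉ e) .isEdge? f = isEdge? H f ×-dec ¬? (Vecₚ.≡-dec Bool._≟_ f e)

-- The vertex set Fin (m + n) stands for the disjoint union: its first m
-- elements are the part V₁ and its last n elements the part V₂.

V₁ : ∀ m n → Subset (m ℕ.+ n)
V₁ m n = ⊤ {m} Vec.++ ⊥ {n}

V₂ : ∀ m n → Subset (m ℕ.+ n)
V₂ m n = ⊥ {m} Vec.++ ⊤ {n}

completeBipartite³ : ∀ m n → Hypergraph (m ℕ.+ n)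
completeBipartite³ m n .IsEdge e =
  ∣ e ∣ ≡ 3 × Nonempty (e ∩ V₁ m n) × Nonempty (e ∩ V₂ m n)
completeBipartite³ m n .isEdge? e =
  (∣ e ∣ ℕ.≟ 3) ×-dec nonempty? (e ∩ V₁ m n) ×-dec nonempty? (e ∩ V₂ m n)

Matrix : Set a → ℕ → Set a
Matrix A N = Fin N → Fin N → A

seidel : Hypergraph N → Matrix ℤ N
seidel H i j with i Fin.≟ j
... | yes _ = 0
... | no  _ = 1 - 2 * + codegree H i j

module _ (R : RawRing c ℓ) where
  private module R = RawRing R
  open RawMonoidDefs R.+-rawMonoid using (sum)
  open RawSemiringDefs R.rawSemiring using () renaming (_^_ to _^ᴿ_)

  -- Laplace expansion along the first row.
  det : Matrix R.Carrier N → R.Carrier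
  det {ℕ.zero}  A = R.1#
  det {ℕ.suc N} A = sum λ j →
    ((R.- R.1#) ^ᴿ toℕ j) R.* (A zero j R.* det (λ i k → A (suc i) (punchIn j k)))

-- A polynomial is its list of coefficients, constant term first; trailing
-- zeros are allowed, so _≋_ compares coefficients.

module Polynomial (R : RawRing c ℓ) where
  private module R = RawRing R

  Poly : Set c
  Poly = List R.Carrier

  coeff : Poly → ℕ → R.Carrier
  coeff []      _         = R.0#
  coeff (x ∷ _) ℕ.zero    = x
  coeff (_ ∷ p) (ℕ.suc k) = coeff p k

  infix 4 _≋_
  _≋_ : Poly → Poly → Set ℓ
  p ≋ q = ∀ k → coeff p k R.≈ coeff q k

  infixl 6 _⊕_
  _⊕_ : Poly → Poly → Poly
  []      ⊕ q       = q
  (x ∷ p) ⊕ []      = x ∷ p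
  (x ∷ p) ⊕ (y ∷ q) = (x R.+ y) ∷ (p ⊕ q)

  infixl 7 _⊗_
  _⊗_ : Poly → Poly → Poly
  []      ⊗ q = []
  (x ∷ p) ⊗ q = map (x R.*_) q ⊕ (R.0# ∷ p ⊗ q)

  ⊖_ : Poly → Poly
  ⊖_ = map (R.-_)

  const : R.Carrier → Poly
  const x = x ∷ []

  X : Poly
  X = R.0# ∷ R.1# ∷ []

  polyRawRing : RawRing c ℓ
  polyRawRing = record
    { Carrier = Poly
    ; _≈_     = _≋_
    ; _+_     = _⊕_
    ; _*_     = _⊗_
    ; -_      = ⊖_
    ; 0#      = []
    ; 1#      = const R.1#
    }

  charPoly : Matrix R.Carrier N → Poly
  charPoly A = det polyRawRing λ i j → xI i j ⊕ (⊖ const (A i j))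
    where
    xI : Matrix Poly _
    xI i j with i Fin.≟ j
    ... | yes _ = X
    ... | no  _ = []

  -- The entries of rs, with repetitions, are all the roots of p with
  -- multiplicity: p splits as c (X - r₁) ⋯ (X - rₖ) with c nonzero.

  RootsWithMultiplicity : Poly → List R.Carrier → Set (c ⊔ ℓ)
  RootsWithMultiplicity p rs = ∃ λ c → ¬ c R.≈ R.0# ×
    p ≋ const c ⊗ foldr (λ r q → (X ⊕ (⊖ const r)) ⊗ q) (const R.1#) rs

-- The library has no real numbers. Classically, ℝ and ℂ are instances of
-- this structure.

record IsFieldOfCharZero (K : CommutativeRing c ℓ) : Set (c ⊔ ℓ) where
  open CommutativeRing K renaming (_*_ to _·_)
  open RawMonoidDefs +-rawMonoid renaming (_×_ to _⋆_) using ()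
  field
    zero⊎invertible : ∀ x → x ≈ 0# ⊎ ∃ λ y → x · y ≈ 1#
    charZero        : ∀ k → ¬ ℕ.suc k ⋆ 1# ≈ 0#

module _ (K : CommutativeRing c ℓ) where
  private module K = CommutativeRing K
  open RawMonoidDefs K.+-rawMonoid renaming (_×_ to _⋆_) using ()
  open Polynomial K.rawRing using (charPoly; RootsWithMultiplicity)

  fromℤ : ℤ → K.Carrier
  fromℤ (+ k)    = k ⋆ K.1#
  fromℤ -[1+ k ] = K.- (ℕ.suc k ⋆ K.1#)

  IsRootsOf : List ℤ → List K.Carrier → Set (c ⊔ ℓ)
  IsRootsOf p = RootsWithMultiplicity (map fromℤ p)

  -- A matrix whose characteristic polynomial does not split over K has no
  -- spectrum in K.
  IsSeidelSpectrum : Hypergraph N → List K.Carrier → Set (c ⊔ ℓ)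
  IsSeidelSpectrum H = RootsWithMultiplicity (charPoly λ i j → fromℤ (seidel H i j))

-- Coefficients of τ⁰, …, τ⁵.
ξ₂ : ℤ → ℤ → List ℤ
ξ₂ m n =
    (- 921 + 873 * m - 408 * m ^ 2 + 84 * m ^ 3 + 2387 * n - 2250 * m * n
       + 1274 * m ^ 2 * n - 368 * m ^ 3 * n + 24 * m ^ 4 * n - 2322 * n ^ 2
       + 1994 * m * n ^ 2 - 680 * m ^ 2 * n ^ 2 + 40 * m ^ 3 * n ^ 2
       + 32 * m ^ 4 * n ^ 2 + 1012 * n ^ 3 - 732 * m * n ^ 3 - 160 * m ^ 2 * n ^ 3
       + 160 * m ^ 3 * n ^ 3 - 32 * m ^ 4 * n ^ 3 - 168 * n ^ 4 + 72 * m * n ^ 4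
       + 160 * m ^ 2 * n ^ 4 - 32 * m ^ 3 * n ^ 4 + 16 * m * n ^ 5 - 32 * m ^ 2 * n ^ 5)
  ∷ (83 - 228 * m - 40 * m ^ 2 + 40 * m ^ 3 + 76 * n - 90 * m * n + 246 * m ^ 2 * n
       - 28 * m ^ 3 * n - 16 * m ^ 4 * n - 366 * n ^ 2 + 238 * m * n ^ 2
       + 132 * m ^ 2 * n ^ 2 - 160 * m ^ 3 * n ^ 2 + 32 * m ^ 4 * n ^ 2 + 248 * n ^ 3
       + 20 * m * n ^ 3 - 184 * m ^ 2 * n ^ 3 + 48 * m ^ 3 * n ^ 3 - 40 * n ^ 4
       - 88 * m * n ^ 4 + 48 * m ^ 2 * n ^ 4 + 16 * m * n ^ 5)
  ∷ (286 - 206 * m + 8 * m ^ 2 + 4 * m ^ 3 - 234 * n + 62 * m * n - 10 * m ^ 2 * n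
       + 40 * m ^ 3 * n - 8 * m ^ 4 * n - 46 * n ^ 2 - 10 * m * n ^ 2
       + 64 * m ^ 2 * n ^ 2 - 24 * m ^ 3 * n ^ 2 + 36 * n ^ 3 + 52 * m * n ^ 3
       - 24 * m ^ 2 * n ^ 3 - 16 * m * n ^ 4)
  ∷ (46 + 4 * m - 8 * m ^ 2 + 4 * n - 22 * m * n - 6 * m ^ 2 * n + 4 * m ^ 3 * n
       - 18 * n ^ 2 + 2 * m * n ^ 2 + 4 * m ^ 2 * n ^ 2 + 4 * m * n ^ 3)
  ∷ (- 5 + 5 * m + 7 * n - 4 * m * n)
  ∷ (- 1)
  ∷ []

{-# OPTIONS --safe #-}
module Submission where

-- A vertex of C³_{m,n} − e enters the Seidel matrix S only through its class:
-- its part, and whether it lies on e.  Hence τI − S is a diagonal matrix plus a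
-- matrix that is constant on pairs of classes, and two vertices of the same
-- class can be merged: subtracting the row of one from that of the other and
-- adding the column of the latter to that of the former splits off the diagonal
-- entry of the class and leaves a matrix of the same shape, in which the merged
-- vertex counts twice.  The four classes have m − 2, 2, n − 1 and 1 elements, so
-- det (τI − S) is (τ − (2n − 1))^(m − 3) (τ − (2m − 1))^(n − 2) times
-- τ − (2n − 3) times a 4 × 4 determinant, and the last two factors multiply to
-- −ξ₂(τ).  All of this happens over ℤ, at integer τ, which is enough because a
-- field of characteristic zero contains infinitely many integers.  The spectrum
-- is then matched by cancelling linear factors.

-- Weights sit on columns because merging is then closed on one family of matrices: apart from the
-- diagonal entries, the two columns that are added are `u` and `v` times the same block column, so
-- only the weights add. A class also receives a block value at a single vertex, where no co-degree
-- exists. This value is formal: it is subtracted in the diagonal part, and that subtraction is what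
-- gives each class its own linear factor. The identity with `ξ₂` in three variables is left to ring
-- normalisation. Over ℤ the coefficients compute, so two normal forms can be compared by `refl`; in
-- an abstract field they could not. The determinant is therefore taken over ℤ and carried into `K`
-- by `fromℤ`. `K` need not be algebraically closed: if `ξ₂` does not split, both sides of the
-- equivalence are empty. So no list of roots can be assumed at the start. Instead `zero⊎invertible`
-- decides whether a given element occurs in a given list of roots, and the known roots are removed
-- from that list one at a time.

open import Defs
open import Algebra.Bundles using (CommutativeRing; RawRing; Semiring)

-- Determinants: transposition, additivity in a row, permuted indices

module Determinant {c ℓ} (R : CommutativeRing c ℓ) where

  open import Data.Empty using (⊥-elim)
  open import Data.Fin using (Fin; zero; suc; toℕ; punchIn)
  open import Data.Fin.Permutation using (Permutation; Permutation′; _⟨$⟩ʳ_; remove; punchIn-permute; ↔⇒≡)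
  open import Data.Fin.Properties using (suc-injective)
  open import Data.Nat using (ℕ; zero; suc)
  open import Data.Vec.Functional using (Vector; _∷_)
  open import Function using (_∘_)
  open import Relation.Binary.PropositionalEquality as ≡ using (_≡_; _≢_)

  open CommutativeRing R hiding (zero)
  open import Algebra.Definitions.RawSemiring (Semiring.rawSemiring semiring) using (_^_)
  open import Algebra.Properties.Ring ring using (-1*x≈-x; -‿involutive)
  open import Algebra.Properties.Semiring.Sum semiring
  open import Algebra.Solver.Ring.NaturalCoefficients.Default commutativeSemiring
    using (solve; _:=_; _:*_)
  open import Relation.Binary.Reasoning.Setoid setoid

  private
    variable
      n : ℕ

  opaque
    -- Opaque, so that a determinant is expanded only where `det-laplace` asks for it; `∣∣ᵈ-unfold`
    -- leads back to `det`.
    ∣_∣ᵈ : Matrix Carrier n → Carrier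
    ∣ A ∣ᵈ = det rawRing A

    ∣∣ᵈ-unfold : (A : Matrix Carrier n) → ∣ A ∣ᵈ ≡ det rawRing A
    ∣∣ᵈ-unfold A = ≡.refl

  sign : Fin n → Carrier
  sign j = (- 1#) ^ toℕ j

  minor : Matrix Carrier (suc n) → Fin (suc n) → Fin (suc n) → Matrix Carrier n
  minor A i j k l = A (punchIn i k) (punchIn j l)

  laplaceTerm : Matrix Carrier (suc n) → Fin (suc n) → Carrier
  laplaceTerm A j = sign j * (A zero j * ∣ minor A zero j ∣ᵈ)

  _ᵀ : Matrix Carrier n → Matrix Carrier n
  (A ᵀ) i j = A j i

  opaque
    unfolding ∣_∣ᵈ

    det-empty : (A : Matrix Carrier zero) → ∣ A ∣ᵈ ≈ 1#
    det-empty A = refl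

    det-laplace : (A : Matrix Carrier (suc n)) → ∣ A ∣ᵈ ≈ sum (laplaceTerm A)
    det-laplace A = refl

  det-cong-laplace : (A B : Matrix Carrier (suc n)) →
    (∀ j → laplaceTerm A j ≈ laplaceTerm B j) → ∣ A ∣ᵈ ≈ ∣ B ∣ᵈ
  det-cong-laplace A B A≈B = trans (det-laplace A) (trans (sum-cong-≋ A≈B) (sym (det-laplace B)))

  det-cong : {A B : Matrix Carrier n} → (∀ i j → A i j ≈ B i j) → ∣ A ∣ᵈ ≈ ∣ B ∣ᵈ
  det-cong {zero}  {A} {B} A≈B = trans (det-empty A) (sym (det-empty B))
  det-cong {suc n} {A} {B} A≈B = det-cong-laplace A B λ j →
    *-congˡ {sign j} (*-cong (A≈B zero j) (det-cong λ i k → A≈B (suc i) (punchIn j k)))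

  private
    rearrange : ∀ s t a b d → (- 1# * s) * (a * (t * (b * d))) ≈ (- 1# * t) * (b * (s * (a * d)))
    rearrange s t a b d = solve 6
      (λ e s t a b d → (e :* s) :* (a :* (t :* (b :* d))) := (e :* t) :* (b :* (s :* (a :* d))))
      refl (- 1#) s t a b d

    TransposeInvariant : ℕ → Set _
    TransposeInvariant n = (A : Matrix Carrier n) → ∣ A ∣ᵈ ≈ ∣ A ᵀ ∣ᵈ

    -- The contribution of the entry in row zero and column `suc j` together with the entry in row
    -- `suc i` and column zero; the remaining minor omits both rows and both columns.
    crossTerm : Matrix Carrier (suc (suc n)) → Fin (suc n) → Fin (suc n) → Carrier
    crossTerm A i j = sign (suc j) *
      (A zero (suc j) * (sign i * (A (suc i) zero * ∣ minor (minor A zero zero) i j ∣ᵈ)))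

    expand-row-column : TransposeInvariant (suc n) → TransposeInvariant n →
      (A : Matrix Carrier (suc (suc n))) →
      ∣ A ∣ᵈ ≈ 1# * (A zero zero * ∣ minor A zero zero ∣ᵈ) +
        ∑[ j < suc n ] ∑[ i < suc n ] crossTerm A i j
    expand-row-column {n} minor-ᵀ minor²-ᵀ A = trans (det-laplace A) (+-congˡ (sum-cong-≋ {suc n} λ j →
      let a = A zero (suc j)
          inner : Fin (suc n) → Carrier
          inner i = sign i * (A (suc i) zero * ∣ minor (minor A zero zero) i j ∣ᵈ)
      in begin
      sign (suc j) * (a * ∣ minor A zero (suc j) ∣ᵈ)
        ≈⟨ *-congˡ (*-congˡ (minor-ᵀ (minor A zero (suc j)))) ⟩
      sign (suc j) * (a * ∣ minor A zero (suc j) ᵀ ∣ᵈ)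
        ≈⟨ *-congˡ (*-congˡ (trans (det-laplace (minor A zero (suc j) ᵀ))
             (sum-cong-≋ {suc n} λ i → *-congˡ {sign i} (*-congˡ {A (suc i) zero}
               (sym (minor²-ᵀ (minor (minor A zero zero) i j))))))) ⟩
      sign (suc j) * (a * sum inner)
        ≈⟨ *-congˡ (*-distribˡ-sum a inner) ⟩
      sign (suc j) * ∑[ i < suc n ] (a * inner i)
        ≈⟨ *-distribˡ-sum (sign (suc j)) (λ i → a * inner i) ⟩
      ∑[ i < suc n ] crossTerm A i j ∎))

  -- Expanding along the first row, and each minor that still meets the first
  -- column along that column, is symmetric in rows and columns.
  det-ᵀ : (A : Matrix Carrier n) → ∣ A ∣ᵈ ≈ ∣ A ᵀ ∣ᵈ
  det-ᵀ {zero}        A = trans (det-empty A) (sym (det-empty (A ᵀ)))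
  det-ᵀ {suc zero}    A = det-cong λ { zero zero → refl }
  det-ᵀ {suc (suc n)} A = begin
    ∣ A ∣ᵈ
      ≈⟨ expand-row-column det-ᵀ det-ᵀ A ⟩
    1# * (A zero zero * ∣ minor A zero zero ∣ᵈ) + ∑[ j < suc n ] ∑[ i < suc n ] crossTerm A i j
      ≈⟨ +-cong (*-congˡ (*-congˡ (det-ᵀ (minor A zero zero)))) (∑-comm λ j i → crossTerm A i j) ⟩
    1# * (A zero zero * ∣ minor (A ᵀ) zero zero ∣ᵈ) + ∑[ i < suc n ] ∑[ j < suc n ] crossTerm A i j
      ≈⟨ +-congˡ (sum-cong-≋ {suc n} λ i → sum-cong-≋ {suc n} λ j → crossTerm-ᵀ i j) ⟩
    1# * (A zero zero * ∣ minor (A ᵀ) zero zero ∣ᵈ) + ∑[ i < suc n ] ∑[ j < suc n ] crossTerm (A ᵀ) j i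
      ≈⟨ expand-row-column det-ᵀ det-ᵀ (A ᵀ) ⟨
    ∣ A ᵀ ∣ᵈ ∎
    where
    crossTerm-ᵀ : ∀ i j → crossTerm A i j ≈ crossTerm (A ᵀ) j i
    crossTerm-ᵀ i j = trans
      (rearrange (sign j) (sign i) (A zero (suc j)) (A (suc i) zero) ∣ minor (minor A zero zero) i j ∣ᵈ)
      (*-congˡ (*-congˡ (*-congˡ (*-congˡ (det-ᵀ (minor (minor A zero zero) i j))))))

  det-+-laplace : (A B C : Matrix Carrier (suc n)) →
    (∀ j → laplaceTerm C j ≈ laplaceTerm A j + laplaceTerm B j) → ∣ C ∣ᵈ ≈ ∣ A ∣ᵈ + ∣ B ∣ᵈ
  det-+-laplace A B C C≈A+B = begin
    ∣ C ∣ᵈ                                     ≈⟨ det-laplace C ⟩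
    sum (laplaceTerm C)                        ≈⟨ sum-cong-≋ C≈A+B ⟩
    sum (λ j → laplaceTerm A j + laplaceTerm B j) ≈⟨ ∑-distrib-+ (laplaceTerm A) (laplaceTerm B) ⟩
    sum (laplaceTerm A) + sum (laplaceTerm B)  ≈⟨ +-cong (det-laplace A) (det-laplace B) ⟨
    ∣ A ∣ᵈ + ∣ B ∣ᵈ                            ∎

  det-row-+ : ∀ (r : Fin n) (A B C : Matrix Carrier n) →
    (∀ j → C r j ≈ A r j + B r j) →
    (∀ i → i ≢ r → ∀ j → C i j ≈ A i j) → (∀ i → i ≢ r → ∀ j → C i j ≈ B i j) →
    ∣ C ∣ᵈ ≈ ∣ A ∣ᵈ + ∣ B ∣ᵈ
  det-row-+ zero A B C C≈A+B C≈A C≈B = det-+-laplace A B C λ j → begin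
    sign j * (C zero j * ∣ minor C zero j ∣ᵈ)
      ≈⟨ *-congˡ {sign j} (trans (*-congʳ (C≈A+B j)) (distribʳ _ (A zero j) (B zero j))) ⟩
    sign j * (A zero j * ∣ minor C zero j ∣ᵈ + B zero j * ∣ minor C zero j ∣ᵈ)
      ≈⟨ *-congˡ {sign j} (+-cong
           (*-congˡ {A zero j} (det-cong λ i k → C≈A (suc i) (λ ()) (punchIn j k)))
           (*-congˡ {B zero j} (det-cong λ i k → C≈B (suc i) (λ ()) (punchIn j k)))) ⟩
    sign j * (A zero j * ∣ minor A zero j ∣ᵈ + B zero j * ∣ minor B zero j ∣ᵈ)
      ≈⟨ distribˡ (sign j) _ _ ⟩
    laplaceTerm A j + laplaceTerm B j ∎
  det-row-+ (suc r) A B C C≈A+B C≈A C≈B = det-+-laplace A B C λ j → begin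
    sign j * (C zero j * ∣ minor C zero j ∣ᵈ)
      ≈⟨ *-congˡ {sign j} (*-congˡ {C zero j} (det-row-+ r (minor A zero j) (minor B zero j) (minor C zero j)
           (λ k → C≈A+B (punchIn j k))
           (λ i i≢r k → C≈A (suc i) (i≢r ∘ suc-injective) (punchIn j k))
           (λ i i≢r k → C≈B (suc i) (i≢r ∘ suc-injective) (punchIn j k)))) ⟩
    sign j * (C zero j * (∣ minor A zero j ∣ᵈ + ∣ minor B zero j ∣ᵈ))
      ≈⟨ trans (*-congˡ {sign j} (distribˡ (C zero j) _ _)) (distribˡ (sign j) _ _) ⟩
    sign j * (C zero j * ∣ minor A zero j ∣ᵈ) + sign j * (C zero j * ∣ minor B zero j ∣ᵈ)
      ≈⟨ +-cong (*-congˡ {sign j} (*-congʳ (C≈A zero (λ ()) j)))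
                (*-congˡ {sign j} (*-congʳ (C≈B zero (λ ()) j))) ⟩
    laplaceTerm A j + laplaceTerm B j ∎

  sum-zero : (f : Fin n → Carrier) → (∀ i → f i ≈ 0#) → sum f ≈ 0#
  sum-zero {n} f f≈0 = trans (sum-cong-≋ f≈0) (sum-replicate-zero n)

  det-pivot : (A : Matrix Carrier (suc n)) → (∀ j → A zero (suc j) ≈ 0#) →
    ∣ A ∣ᵈ ≈ A zero zero * ∣ minor A zero zero ∣ᵈ
  det-pivot A A₀≈0 = trans (det-laplace A) (trans
    (+-cong (*-identityˡ _) (sum-zero (λ j → laplaceTerm A (suc j)) λ j → trans
      (*-congˡ {sign (suc j)} (trans (*-congʳ (A₀≈0 j)) (zeroˡ _))) (zeroʳ (sign (suc j)))))
    (+-identityʳ _))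

  x+-1x≈0 : ∀ x → x + - 1# * x ≈ 0#
  x+-1x≈0 x = trans (+-congˡ (-1*x≈-x x)) (-‿inverseʳ x)

  -- The first two Laplace terms have equal minors and opposite signs. Every later minor still
  -- begins with two equal columns and vanishes by induction.
  det-equal-columns : (A : Matrix Carrier (suc (suc n))) →
    (∀ i → A i zero ≈ A i (suc zero)) → ∣ A ∣ᵈ ≈ 0#
  det-equal-columns {n} A A₀≈A₁ = begin
    ∣ A ∣ᵈ
      ≈⟨ det-laplace A ⟩
    1# * (a₀ * d₀) + (- 1# * 1# * (a₁ * d₁) + rest)
      ≈⟨ +-cong (*-identityˡ _) (+-cong (*-cong (*-identityʳ _) (sym (*-cong (A₀≈A₁ zero) minors≈))) (sum-zero (term A) (later n A A₀≈A₁))) ⟩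
    a₀ * d₀ + (- 1# * (a₀ * d₀) + 0#)
      ≈⟨ +-congˡ (+-identityʳ _) ⟩
    a₀ * d₀ + - 1# * (a₀ * d₀)
      ≈⟨ x+-1x≈0 _ ⟩
    0# ∎
    where
    a₀ = A zero zero
    a₁ = A zero (suc zero)
    d₀ = ∣ minor A zero zero ∣ᵈ
    d₁ = ∣ minor A zero (suc zero) ∣ᵈ

    term : ∀ {n} → Matrix Carrier (suc (suc n)) → Fin n → Carrier
    term A j = laplaceTerm A (suc (suc j))

    rest = sum (term A)

    minors≈ : d₀ ≈ d₁
    minors≈ = det-cong λ { i zero → sym (A₀≈A₁ (suc i)) ; i (suc k) → refl }

    later : ∀ n (A : Matrix Carrier (suc (suc n))) → (∀ i → A i zero ≈ A i (suc zero)) →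
      ∀ j → term A j ≈ 0#
    later (suc n) A A₀≈A₁ j = trans
      (*-congˡ {sign (suc (suc j))} (trans
        (*-congˡ {A zero (suc (suc j))} (det-equal-columns (minor A zero (suc (suc j))) λ i → A₀≈A₁ (suc i)))
        (zeroʳ (A zero (suc (suc j))))))
      (zeroʳ (sign (suc (suc j))))

  det-equal-rows : (A : Matrix Carrier (suc (suc n))) →
    (∀ j → A zero j ≈ A (suc zero) j) → ∣ A ∣ᵈ ≈ 0#
  det-equal-rows A A₀≈A₁ = trans (det-ᵀ A) (det-equal-columns (A ᵀ) A₀≈A₁)

  -- Polarisation: expand the vanishing determinant with `a + b` in both leading rows.
  det-swap-rows : (a b : Vector Carrier (suc (suc n))) (M : Fin n → Vector Carrier (suc (suc n))) →
    ∣ a ∷ b ∷ M ∣ᵈ ≈ - 1# * ∣ b ∷ a ∷ M ∣ᵈ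
  det-swap-rows {n} a b M = begin
    ∣ab∣                              ≈⟨ +-identityʳ _ ⟨
    ∣ab∣ + 0#                         ≈⟨ +-congˡ (x+-1x≈0 _) ⟨
    ∣ab∣ + (∣ba∣ + - 1# * ∣ba∣)       ≈⟨ +-assoc _ _ _ ⟨
    (∣ab∣ + ∣ba∣) + - 1# * ∣ba∣       ≈⟨ +-congʳ sum≈0 ⟩
    0# + - 1# * ∣ba∣                  ≈⟨ +-identityˡ _ ⟩
    - 1# * ∣ba∣                       ∎
    where
    ∣ab∣ = ∣ a ∷ b ∷ M ∣ᵈ
    ∣ba∣ = ∣ b ∷ a ∷ M ∣ᵈ
    s : Vector Carrier (suc (suc n))
    s j = a j + b j

    split₁ : ∀ x → ∣ x ∷ s ∷ M ∣ᵈ ≈ ∣ x ∷ a ∷ M ∣ᵈ + ∣ x ∷ b ∷ M ∣ᵈ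
    split₁ x = det-row-+ (suc zero) (x ∷ a ∷ M) (x ∷ b ∷ M) (x ∷ s ∷ M) (λ _ → refl)
      (λ { zero _ _ → refl ; (suc zero) 1≢1 → ⊥-elim (1≢1 ≡.refl) ; (suc (suc _)) _ _ → refl })
      (λ { zero _ _ → refl ; (suc zero) 1≢1 → ⊥-elim (1≢1 ≡.refl) ; (suc (suc _)) _ _ → refl })

    split₀ : ∣ s ∷ s ∷ M ∣ᵈ ≈ ∣ a ∷ s ∷ M ∣ᵈ + ∣ b ∷ s ∷ M ∣ᵈ
    split₀ = det-row-+ zero (a ∷ s ∷ M) (b ∷ s ∷ M) (s ∷ s ∷ M) (λ _ → refl)
      (λ { zero 0≢0 → ⊥-elim (0≢0 ≡.refl) ; (suc _) _ _ → refl })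
      (λ { zero 0≢0 → ⊥-elim (0≢0 ≡.refl) ; (suc _) _ _ → refl })

    repeated : ∀ x → ∣ x ∷ x ∷ M ∣ᵈ ≈ 0#
    repeated x = det-equal-rows (x ∷ x ∷ M) λ _ → refl

    sum≈0 : ∣ab∣ + ∣ba∣ ≈ 0#
    sum≈0 = begin
      ∣ab∣ + ∣ba∣
        ≈⟨ +-cong (+-identityˡ _) (+-identityʳ _) ⟨
      (0# + ∣ab∣) + (∣ba∣ + 0#)
        ≈⟨ +-cong (+-congʳ (repeated a)) (+-congˡ (repeated b)) ⟨
      (∣ a ∷ a ∷ M ∣ᵈ + ∣ab∣) + (∣ba∣ + ∣ b ∷ b ∷ M ∣ᵈ)
        ≈⟨ +-cong (split₁ a) (split₁ b) ⟨
      ∣ a ∷ s ∷ M ∣ᵈ + ∣ b ∷ s ∷ M ∣ᵈ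
        ≈⟨ split₀ ⟨
      ∣ s ∷ s ∷ M ∣ᵈ
        ≈⟨ repeated s ⟩
      0# ∎

  toFront : Fin (suc n) → Fin (suc n) → Fin (suc n)
  toFront i zero    = i
  toFront i (suc k) = punchIn i k

  det-scale-minors : ∀ x (A B : Matrix Carrier (suc n)) → (∀ j → A zero j ≈ B zero j) →
    (∀ j → ∣ minor A zero j ∣ᵈ ≈ x * ∣ minor B zero j ∣ᵈ) → ∣ A ∣ᵈ ≈ x * ∣ B ∣ᵈ
  det-scale-minors x A B A₀≈B₀ minors = begin
    ∣ A ∣ᵈ                            ≈⟨ det-laplace A ⟩
    sum (laplaceTerm A)               ≈⟨ sum-cong-≋ scale ⟩
    sum (λ j → x * laplaceTerm B j)   ≈⟨ *-distribˡ-sum x (laplaceTerm B) ⟨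
    x * sum (laplaceTerm B)           ≈⟨ *-congˡ (det-laplace B) ⟨
    x * ∣ B ∣ᵈ                        ∎
    where
    scale : ∀ j → laplaceTerm A j ≈ x * laplaceTerm B j
    scale j = trans
      (*-congˡ {sign j} (*-cong (A₀≈B₀ j) (minors j)))
      (solve 4 (λ s a x d → s :* (a :* (x :* d)) := x :* (s :* (a :* d))) refl
        (sign j) (B zero j) x ∣ minor B zero j ∣ᵈ)

  -- After one swap with row zero, the rest of the move takes place inside the minors below row
  -- zero; each step costs one sign.
  det-toFront : ∀ i (A : Matrix Carrier (suc n)) → ∣ (λ k → A (toFront i k)) ∣ᵈ ≈ sign i * ∣ A ∣ᵈ
  det-toFront zero A = trans
    (det-cong λ { zero _ → refl ; (suc _) _ → refl }) (sym (*-identityˡ _))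
  det-toFront {suc n} (suc i) A = begin
    ∣ (λ k → A (toFront (suc i) k)) ∣ᵈ
      ≈⟨ det-cong (λ { zero _ → refl ; (suc zero) _ → refl ; (suc (suc _)) _ → refl }) ⟩
    ∣ A (suc i) ∷ A zero ∷ (λ k → A (suc (punchIn i k))) ∣ᵈ
      ≈⟨ det-swap-rows (A (suc i)) (A zero) (λ k → A (suc (punchIn i k))) ⟩
    - 1# * ∣ A zero ∷ A (suc i) ∷ (λ k → A (suc (punchIn i k))) ∣ᵈ
      ≈⟨ *-congˡ (det-scale-minors (sign i) _ A (λ _ → refl) λ j → trans
           (det-cong λ { zero _ → refl ; (suc _) _ → refl }) (det-toFront i (minor A zero j))) ⟩
    - 1# * (sign i * ∣ A ∣ᵈ)
      ≈⟨ *-assoc _ _ _ ⟨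
    sign (suc i) * ∣ A ∣ᵈ ∎

  -- The sign of a permutation: the image of zero is moved to the front, then the remaining
  -- permutation is treated in the same way.
  permSign : Permutation′ n → Carrier
  permSign {zero}  ρ = 1#
  permSign {suc n} ρ = sign (ρ ⟨$⟩ʳ zero) * permSign (remove zero ρ)

  det-permute-rows : ∀ (ρ : Permutation′ n) (A : Matrix Carrier n) →
    ∣ (λ i → A (ρ ⟨$⟩ʳ i)) ∣ᵈ ≈ permSign ρ * ∣ A ∣ᵈ
  det-permute-rows {zero}  ρ A = trans (det-cong λ ()) (sym (*-identityˡ _))
  det-permute-rows {suc n} ρ A = begin
    ∣ (λ i → A (ρ ⟨$⟩ʳ i)) ∣ᵈ
      ≈⟨ det-scale-minors (permSign (remove zero ρ)) _ (λ k → A (toFront (ρ ⟨$⟩ʳ zero) k)) (λ _ → refl)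
           (λ j → trans
             (det-cong λ i k → reflexive (≡.cong (λ r → A r (punchIn j k)) (punchIn-permute ρ zero i)))
             (det-permute-rows (remove zero ρ) λ k → λ l → A (punchIn (ρ ⟨$⟩ʳ zero) k) (punchIn j l))) ⟩
    permSign (remove zero ρ) * ∣ (λ k → A (toFront (ρ ⟨$⟩ʳ zero) k)) ∣ᵈ
      ≈⟨ *-congˡ (det-toFront (ρ ⟨$⟩ʳ zero) A) ⟩
    permSign (remove zero ρ) * (sign (ρ ⟨$⟩ʳ zero) * ∣ A ∣ᵈ)
      ≈⟨ solve 3 (λ p s d → p :* (s :* d) := (s :* p) :* d) refl _ _ _ ⟩
    permSign ρ * ∣ A ∣ᵈ ∎

  private
    *-square-≈1 : ∀ x y → x * x ≈ 1# → y * y ≈ 1# → (x * y) * (x * y) ≈ 1#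
    *-square-≈1 x y x²≈1 y²≈1 = begin
      (x * y) * (x * y) ≈⟨ solve 2 (λ x y → (x :* y) :* (x :* y) := (x :* x) :* (y :* y)) refl x y ⟩
      (x * x) * (y * y) ≈⟨ *-cong x²≈1 y²≈1 ⟩
      1# * 1#           ≈⟨ *-identityˡ _ ⟩
      1#                ∎

  sign-involutive : (i : Fin n) → sign i * sign i ≈ 1#
  sign-involutive zero    = *-identityˡ _
  sign-involutive (suc i) = *-square-≈1 (- 1#) (sign i)
    (trans (-1*x≈-x (- 1#)) (-‿involutive 1#)) (sign-involutive i)

  permSign-involutive : (ρ : Permutation′ n) → permSign ρ * permSign ρ ≈ 1#
  permSign-involutive {zero}  ρ = *-identityˡ _
  permSign-involutive {suc n} ρ = *-square-≈1 (sign (ρ ⟨$⟩ʳ zero)) (permSign (remove zero ρ))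
    (sign-involutive (ρ ⟨$⟩ʳ zero)) (permSign-involutive (remove zero ρ))

  -- The sign arises once for the rows and once for the columns, and squares to one. The sizes are
  -- kept apart because a permutation of lists gives a bijection between the index sets of two
  -- different lists.
  det-reindex : ∀ {m} (ρ : Permutation m n) (A : Matrix Carrier n) →
    ∣ (λ i j → A (ρ ⟨$⟩ʳ i) (ρ ⟨$⟩ʳ j)) ∣ᵈ ≈ ∣ A ∣ᵈ
  det-reindex {n} ρ A with ↔⇒≡ ρ
  ... | ≡.refl = begin
    ∣ (λ i j → A (ρ ⟨$⟩ʳ i) (ρ ⟨$⟩ʳ j)) ∣ᵈ
      ≈⟨ det-permute-rows ρ (λ i j → A i (ρ ⟨$⟩ʳ j)) ⟩
    permSign ρ * ∣ (λ i j → A i (ρ ⟨$⟩ʳ j)) ∣ᵈ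
      ≈⟨ *-congˡ (trans (det-ᵀ {n} _) (det-permute-rows ρ (A ᵀ))) ⟩
    permSign ρ * (permSign ρ * ∣ A ᵀ ∣ᵈ)
      ≈⟨ trans (sym (*-assoc _ _ _)) (*-congʳ (permSign-involutive ρ)) ⟩
    1# * ∣ A ᵀ ∣ᵈ
      ≈⟨ trans (*-identityˡ _) (sym (det-ᵀ A)) ⟩
    ∣ A ∣ᵈ ∎

-- Vertex classes and the quotient matrix

module VertexClasses where

  open import Data.Bool using (Bool; true; false; if_then_else_; _∧_)
  open import Data.Fin as Fin using (Fin)
  open import Data.List using (List; []; _∷_; lookup)
  open import Data.Product using (_×_; _,_; proj₁; proj₂)
  open import Relation.Nullary using (does)

  data Part : Set where
    left right : Part

  -- The part of a vertex, and whether it lies in the removed hyperedge.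
  Class : Set
  Class = Part × Bool

  -- Over a raw ring, so that the same definitions run on integers and on solver expressions, which
  -- satisfy no ring laws.
  module RawClassMatrix {c ℓ} (R : RawRing c ℓ) where
    open RawRing R

    onDiagonal : ∀ {n} → Fin n → Fin n → Carrier → Carrier
    onDiagonal i j x = if does (i Fin.≟ j) then x else 0#

    -- Each index stands for a class together with the number of vertices that it
    -- represents.
    classMatrix : ∀ {a n} {A : Set a} → (A → Carrier) → (A → A → Carrier) →
      (Fin n → A × Carrier) → Matrix Carrier n
    classMatrix diagonal block x i j =
      onDiagonal i j (diagonal (proj₁ (x i))) + proj₂ (x j) * block (proj₁ (x i)) (proj₁ (x j))

    module _ (m n : Carrier) where
      -- Counts the choices of the third vertex: any vertex of the other part if both lie in one
      -- part, any further vertex if they lie in different parts. The removed hyperedge is deducted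
      -- when both vertices lie on it.
      classCodegree : Class → Class → Carrier
      classCodegree (P , a) (Q , b) = inside-parts P Q + - (if a ∧ b then 1# else 0#)
        where
        inside-parts : Part → Part → Carrier
        inside-parts left  left  = n
        inside-parts right right = m
        inside-parts left  right = (m + n) + - (1# + 1#)
        inside-parts right left  = (m + n) + - (1# + 1#)

      -- Off-diagonal entry of −S.
      block : Class → Class → Carrier
      block p q = (1# + 1#) * classCodegree p q + - 1#

      diagonal : Carrier → Class → Carrier
      diagonal k p = k + - block p p

      -- The classes with their sizes, in the order in which classDet-four leaves them.
      quotient : List (Class × Carrier)
      quotient = ((right , true) , 1#) ∷ ((left , false) , m + - (1# + 1#))
               ∷ ((left , true) , 1# + 1#) ∷ ((right , false) , n + - 1#) ∷ []

      reducedCharPoly : Carrier → Carrier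
      reducedCharPoly k =
        diagonal k (left , true) * det R (classMatrix (diagonal k) block (lookup quotient))

-- Merging vertices of the same class

module ClassDeterminant {c ℓ} (R : CommutativeRing c ℓ) where

  open import Data.Empty using (⊥-elim)
  open import Data.Fin as Fin using (Fin; zero; suc)
  open import Data.Fin.Permutation using (Permutation; _⟨$⟩ʳ_; cast-id)
  open import Data.List as List using (List; []; _∷_; lookup; length; replicate; _++_; _∷ʳ_; [_])
  open import Data.List.Properties using (++-assoc)
  import Data.List.Relation.Binary.Permutation.Homogeneous as ↭ₕ
  open import Data.List.Relation.Binary.Permutation.Propositional using (_↭_; ↭⇒↭ₛ)
  open import Data.List.Relation.Binary.Permutation.Propositional.Properties using (∷↭∷ʳ)
  import Data.List.Relation.Binary.Permutation.Setoid.Properties as ↭ₛ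
  open import Data.Nat using (ℕ; zero; suc)
  open import Data.Product using (_×_; _,_; proj₁; proj₂)
  open import Data.Vec as Vec using (Vec; toList)
  open import Data.Vec.Properties using (length-toList)
  open import Function using (_∘_; Injection)
  open import Function.Properties.Inverse using (↔⇒↣)
  open import Relation.Binary.PropositionalEquality as ≡ using (_≡_)
  open import Relation.Nullary using (yes; no)

  open CommutativeRing R hiding (zero)
  open import Algebra.Definitions.RawMonoid +-rawMonoid using () renaming (_×_ to _⋆_)
  open import Algebra.Definitions.RawSemiring (Semiring.rawSemiring semiring) using (_^_)
  open import Algebra.Solver.Ring.NaturalCoefficients.Default commutativeSemiring
    using (solve; con; _:=_; _:*_; _:+_)
  open import Relation.Binary.Reasoning.Setoid setoid
  open Determinant R
  open VertexClasses

  private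
    variable
      n : ℕ

  open RawClassMatrix rawRing using (onDiagonal; classMatrix)

  module _ {a} {A : Set a} (diagonal : A → Carrier) (block : A → A → Carrier) where

    Weighted : Set _
    Weighted = A × Carrier

    classMat : (Fin n → Weighted) → Matrix Carrier n
    classMat = classMatrix diagonal block

    classDet : List Weighted → Carrier
    classDet xs = ∣ classMat (lookup xs) ∣ᵈ

    classMatrix-cong : {x y : Fin n → Weighted} → (∀ i → x i ≡ y i) →
      ∀ i j → classMat x i j ≡ classMat y i j
    classMatrix-cong x≡y i j = ≡.cong₂
      (λ p q → onDiagonal i j (diagonal (proj₁ p)) + proj₂ q * block (proj₁ p) (proj₁ q)) (x≡y i) (x≡y j)

    classMatrix-reindex : ∀ {m} (ρ : Permutation m n) {x : Fin m → Weighted} (y : Fin n → Weighted) →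
      (∀ i → x i ≡ y (ρ ⟨$⟩ʳ i)) → ∣ classMat x ∣ᵈ ≈ ∣ classMat y ∣ᵈ
    classMatrix-reindex ρ {x} y x≡y∘ρ = begin
      ∣ classMat x ∣ᵈ
        ≈⟨ det-cong (λ i j → reflexive (classMatrix-cong x≡y∘ρ i j)) ⟩
      ∣ classMat (y ∘ (ρ ⟨$⟩ʳ_)) ∣ᵈ
        ≈⟨ det-cong (λ i j → +-congʳ (reflexive (onDiagonal-ρ i j _))) ⟩
      ∣ (λ i j → classMat y (ρ ⟨$⟩ʳ i) (ρ ⟨$⟩ʳ j)) ∣ᵈ
        ≈⟨ det-reindex ρ (classMat y) ⟩
      ∣ classMat y ∣ᵈ ∎
      where
      onDiagonal-ρ : ∀ i j x → onDiagonal i j x ≡ onDiagonal (ρ ⟨$⟩ʳ i) (ρ ⟨$⟩ʳ j) x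
      onDiagonal-ρ i j x with i Fin.≟ j | (ρ ⟨$⟩ʳ i) Fin.≟ (ρ ⟨$⟩ʳ j)
      ... | yes _   | yes _   = ≡.refl
      ... | yes i≡j | no ρ≢   = ⊥-elim (ρ≢ (≡.cong (ρ ⟨$⟩ʳ_) i≡j))
      ... | no i≢j  | yes ρ≡  = ⊥-elim (i≢j (Injection.injective (↔⇒↣ ρ) ρ≡))
      ... | no _    | no _    = ≡.refl

    -- Rows and columns move together, so no sign appears. This allows the vertices to be sorted by
    -- class.
    classDet-↭ : ∀ {xs ys} → xs ↭ ys → classDet xs ≈ classDet ys
    classDet-↭ {xs} {ys} xs↭ys = classMatrix-reindex (↭ₕ.onIndices (↭⇒↭ₛ xs↭ys)) (lookup ys)
      (↭ₛ.onIndices-lookup (≡.setoid Weighted) (↭⇒↭ₛ xs↭ys))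

    classDet-toList : (v : Vec Weighted n) → classDet (toList v) ≈ ∣ classMat (Vec.lookup v) ∣ᵈ
    classDet-toList v = classMatrix-reindex (cast-id (length-toList v)) (Vec.lookup v) (lookup-toList v)
      where
      lookup-toList : ∀ {n} (v : Vec Weighted n) i →
        lookup (toList v) i ≡ Vec.lookup v (Fin.cast (length-toList v) i)
      lookup-toList (x Vec.∷ v) zero    = ≡.refl
      lookup-toList (x Vec.∷ v) (suc i) = lookup-toList v i

    -- Subtracting the second row from the first and then adding the first column
    -- to the second leaves only the diagonal entry in the first row.
    classDet-merge : ∀ p u v xs →
      classDet ((p , u) ∷ (p , v) ∷ xs) ≈ diagonal p * classDet ((p , u + v) ∷ xs)
    classDet-merge p u v xs = begin
      ∣ M ∣ᵈ
        ≈⟨ det-row-+ zero N M₁ M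
             (λ { zero → sym (+-congˡ (+-identityˡ _))
                ; (suc zero) → trans (+-identityˡ _) (sym (trans (sym (+-assoc _ _ _)) (trans (+-congʳ (-‿inverseˡ _)) (+-identityˡ _))))
                ; (suc (suc j)) → sym (+-identityˡ _) })
             (λ { zero 0≢0 → ⊥-elim (0≢0 ≡.refl) ; (suc _) _ _ → refl })
             (λ { zero 0≢0 → ⊥-elim (0≢0 ≡.refl) ; (suc _) _ _ → refl }) ⟩
      ∣ N ∣ᵈ + ∣ M₁ ∣ᵈ
        ≈⟨ trans (+-congˡ (det-equal-rows M₁ λ _ → refl)) (+-identityʳ _) ⟩
      ∣ N ∣ᵈ
        ≈⟨ trans (+-congˡ (det-equal-columns N₀ λ _ → refl)) (+-identityʳ _) ⟨
      ∣ N ∣ᵈ + ∣ N₀ ∣ᵈ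
        ≈⟨ +-cong (det-ᵀ N) (det-ᵀ N₀) ⟩
      ∣ N ᵀ ∣ᵈ + ∣ N₀ ᵀ ∣ᵈ
        ≈⟨ det-row-+ (suc zero) (N ᵀ) (N₀ ᵀ) (P ᵀ) (λ _ → refl)
             (λ { zero _ _ → refl ; (suc zero) 1≢1 → ⊥-elim (1≢1 ≡.refl) ; (suc (suc _)) _ _ → refl })
             (λ { zero _ _ → refl ; (suc zero) 1≢1 → ⊥-elim (1≢1 ≡.refl) ; (suc (suc _)) _ _ → refl }) ⟨
      ∣ P ᵀ ∣ᵈ
        ≈⟨ det-ᵀ P ⟨
      ∣ P ∣ᵈ
        ≈⟨ det-pivot P (λ { zero → -‿inverseˡ _ ; (suc j) → refl }) ⟩
      diagonal p * ∣ minor P zero zero ∣ᵈ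
        ≈⟨ *-congˡ (det-cong λ
             { zero zero    → solve 4 (λ d u v b → (d :+ v :* b) :+ (con 0 :+ u :* b) := d :+ (u :+ v) :* b) refl _ u v _
             ; (suc i) zero → solve 3 (λ u v b → (con 0 :+ v :* b) :+ (con 0 :+ u :* b) := con 0 :+ (u :+ v) :* b) refl u v _
             ; zero (suc j)    → refl
             ; (suc i) (suc j) → refl }) ⟩
      diagonal p * classDet ((p , u + v) ∷ xs) ∎
      where
      M N M₁ N₀ P : Matrix Carrier (suc (suc (length xs)))
      M = classMat (lookup ((p , u) ∷ (p , v) ∷ xs))

      -- Both operations are expressed by additivity: `M` is `N` plus `M₁` in the first row, and `P`
      -- is `N` plus `N₀` in the second column. `M₁` repeats a row and `N₀` a column, so both have
      -- determinant zero.
      N zero zero          = diagonal p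
      N zero (suc zero)    = - diagonal p
      N zero (suc (suc _)) = 0#
      N (suc i) j          = M (suc i) j

      M₁ zero    j = M (suc zero) j
      M₁ (suc i) j = M (suc i) j

      N₀ i zero          = N i zero
      N₀ i (suc zero)    = N i zero
      N₀ i (suc (suc j)) = N i (suc (suc j))

      P i zero          = N i zero
      P i (suc zero)    = N i (suc zero) + N i zero
      P i (suc (suc j)) = N i (suc (suc j))

    classDet-weight : ∀ p xs {u v} → u ≈ v → classDet ((p , u) ∷ xs) ≈ classDet ((p , v) ∷ xs)
    classDet-weight p xs u≈v = det-cong λ
      { zero    zero    → +-congˡ (*-congʳ u≈v)
      ; (suc i) zero    → +-congˡ (*-congʳ u≈v)
      ; zero    (suc j) → refl
      ; (suc i) (suc j) → refl }

    -- The weight `u` is an accumulator: the merged vertex stays at the head while the induction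
    -- consumes the copies behind it.
    classDet-merge-replicate : ∀ p k u xs →
      classDet ((p , u) ∷ replicate k (p , 1#) ++ xs) ≈ diagonal p ^ k * classDet ((p , u + k ⋆ 1#) ∷ xs)
    classDet-merge-replicate p zero    u xs = trans
      (classDet-weight p xs (sym (+-identityʳ u)))
      (sym (*-identityˡ _))
    classDet-merge-replicate p (suc k) u xs = begin
      classDet ((p , u) ∷ (p , 1#) ∷ replicate k (p , 1#) ++ xs)
        ≈⟨ classDet-merge p u 1# (replicate k (p , 1#) ++ xs) ⟩
      diagonal p * classDet ((p , u + 1#) ∷ replicate k (p , 1#) ++ xs)
        ≈⟨ *-congˡ (classDet-merge-replicate p k (u + 1#) xs) ⟩
      diagonal p * (diagonal p ^ k * classDet ((p , (u + 1#) + k ⋆ 1#) ∷ xs))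
        ≈⟨ trans (sym (*-assoc _ _ _)) (*-congˡ (classDet-weight p xs (+-assoc _ _ _))) ⟩
      diagonal p ^ suc k * classDet ((p , u + suc k ⋆ 1#) ∷ xs) ∎

    -- Merging acts at the head of the list; sending the merged vertex to the end brings the next
    -- class to the head.
    classDet-gather : ∀ p k xs →
      classDet (replicate (suc k) (p , 1#) ++ xs) ≈ diagonal p ^ k * classDet (xs ∷ʳ (p , suc k ⋆ 1#))
    classDet-gather p k xs = trans (classDet-merge-replicate p k 1# xs)
      (*-congˡ (classDet-↭ (∷↭∷ʳ (p , suc k ⋆ 1#) xs)))

    -- Three classes go to the end in turn, which leaves the single vertex of the fourth in front. A
    -- class of `suc k` vertices is merged `k` times, hence the exponents.
    classDet-four : ∀ p k q l r s t →
      classDet (replicate (suc k) (p , 1#) ++ replicate (suc l) (q , 1#) ++ replicate (suc s) (r , 1#) ++ (t , 1#) ∷ []) ≈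
      diagonal p ^ k * (diagonal q ^ l * (diagonal r ^ s *
        classDet ((t , 1#) ∷ (p , suc k ⋆ 1#) ∷ (q , suc l ⋆ 1#) ∷ (r , suc s ⋆ 1#) ∷ [])))
    classDet-four p k q l r s t = trans (classDet-gather p k (qs ++ rs ++ ts)) (*-congˡ (trans
      (reflexive (≡.cong classDet (≡.trans (++-assoc qs (rs ++ ts) _) (≡.cong (qs ++_) (++-assoc rs ts _)))))
      (trans (classDet-gather q l (rs ++ ts ++ [ p , suc k ⋆ 1# ])) (*-congˡ (trans
        (reflexive (≡.cong classDet (++-assoc rs (ts ++ [ p , suc k ⋆ 1# ]) _)))
        (classDet-gather r s (ts ++ [ p , suc k ⋆ 1# ] ++ [ q , suc l ⋆ 1# ])))))))
      where
      qs = replicate (suc l) (q , 1#)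
      rs = replicate (suc s) (r , 1#)
      ts = [ t , 1# ]

-- The four by four determinant and the quintic

module QuotientDeterminant where

  open import Data.Fin using (zero; suc)
  open import Data.Integer using (ℤ; +_; +-*-rawRing) renaming (_+_ to _+ᶻ_; _*_ to _*ᶻ_; -_ to -ᶻ_)
  open import Data.Integer.Solver using (module +-*-Solver)
  open import Data.List using (List; foldr)
  open import Data.Nat using (ℕ)
  open import Data.Vec using ([]; _∷_)
  open import Relation.Binary.PropositionalEquality using (_≡_; refl)
  open +-*-Solver
  open VertexClasses

  -- With solver syntax as a raw ring, `reducedCharPoly` itself writes down the expression to be
  -- normalised, determinant included.
  polynomialRawRing : ℕ → RawRing _ _
  polynomialRawRing N = record
    { Carrier = Polynomial N ; _≈_ = _≡_ ; _+_ = _:+_ ; _*_ = _:*_ ; -_ = :-_ ; 0# = con (+ 0) ; 1# = con (+ 1) }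

  infix 9 #_
  #_ : ℕ → Polynomial 3
  # i = con (+ i)

  horner : ℤ → List ℤ → ℤ
  horner k = foldr (λ x y → x +ᶻ k *ᶻ y) (+ 0)

  -- A copy of ξ₂ in Horner form, which the ring solver needs as syntax.
  ξ₂-polynomial : Polynomial 3 → Polynomial 3 → Polynomial 3 → Polynomial 3
  ξ₂-polynomial m n k =
      (:- # 921 :+ # 873 :* m :- # 408 :* m :^ 2 :+ # 84 :* m :^ 3 :+ # 2387 :* n :- # 2250 :* m :* n
         :+ # 1274 :* m :^ 2 :* n :- # 368 :* m :^ 3 :* n :+ # 24 :* m :^ 4 :* n :- # 2322 :* n :^ 2
         :+ # 1994 :* m :* n :^ 2 :- # 680 :* m :^ 2 :* n :^ 2 :+ # 40 :* m :^ 3 :* n :^ 2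
         :+ # 32 :* m :^ 4 :* n :^ 2 :+ # 1012 :* n :^ 3 :- # 732 :* m :* n :^ 3 :- # 160 :* m :^ 2 :* n :^ 3
         :+ # 160 :* m :^ 3 :* n :^ 3 :- # 32 :* m :^ 4 :* n :^ 3 :- # 168 :* n :^ 4 :+ # 72 :* m :* n :^ 4
         :+ # 160 :* m :^ 2 :* n :^ 4 :- # 32 :* m :^ 3 :* n :^ 4 :+ # 16 :* m :* n :^ 5 :- # 32 :* m :^ 2 :* n :^ 5)
    :+ k :* ((# 83 :- # 228 :* m :- # 40 :* m :^ 2 :+ # 40 :* m :^ 3 :+ # 76 :* n :- # 90 :* m :* n :+ # 246 :* m :^ 2 :* n
         :- # 28 :* m :^ 3 :* n :- # 16 :* m :^ 4 :* n :- # 366 :* n :^ 2 :+ # 238 :* m :* n :^ 2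
         :+ # 132 :* m :^ 2 :* n :^ 2 :- # 160 :* m :^ 3 :* n :^ 2 :+ # 32 :* m :^ 4 :* n :^ 2 :+ # 248 :* n :^ 3
         :+ # 20 :* m :* n :^ 3 :- # 184 :* m :^ 2 :* n :^ 3 :+ # 48 :* m :^ 3 :* n :^ 3 :- # 40 :* n :^ 4
         :- # 88 :* m :* n :^ 4 :+ # 48 :* m :^ 2 :* n :^ 4 :+ # 16 :* m :* n :^ 5)
    :+ k :* ((# 286 :- # 206 :* m :+ # 8 :* m :^ 2 :+ # 4 :* m :^ 3 :- # 234 :* n :+ # 62 :* m :* n :- # 10 :* m :^ 2 :* n
         :+ # 40 :* m :^ 3 :* n :- # 8 :* m :^ 4 :* n :- # 46 :* n :^ 2 :- # 10 :* m :* n :^ 2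
         :+ # 64 :* m :^ 2 :* n :^ 2 :- # 24 :* m :^ 3 :* n :^ 2 :+ # 36 :* n :^ 3 :+ # 52 :* m :* n :^ 3
         :- # 24 :* m :^ 2 :* n :^ 3 :- # 16 :* m :* n :^ 4)
    :+ k :* ((# 46 :+ # 4 :* m :- # 8 :* m :^ 2 :+ # 4 :* n :- # 22 :* m :* n :- # 6 :* m :^ 2 :* n :+ # 4 :* m :^ 3 :* n
         :- # 18 :* n :^ 2 :+ # 2 :* m :* n :^ 2 :+ # 4 :* m :^ 2 :* n :^ 2 :+ # 4 :* m :* n :^ 3)
    :+ k :* ((:- # 5 :+ # 5 :* m :+ # 7 :* n :- # 4 :* m :* n)
    :+ k :* ((:- # 1) :+ k :* con (+ 0))))))

  -- The two expressions evaluate by definition to the two sides, and their normal forms coincide.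
  -- The sign reflects that a characteristic polynomial is monic while `ξ₂` has leading coefficient
  -- -1.
  reducedCharPoly-ξ₂ : ∀ m n k → RawClassMatrix.reducedCharPoly +-*-rawRing m n k ≡ -ᶻ horner k (ξ₂ m n)
  reducedCharPoly-ξ₂ m n k = prove (m ∷ n ∷ k ∷ [])
    (RawClassMatrix.reducedCharPoly (polynomialRawRing 3) (var zero) (var (suc zero)) (var (suc (suc zero))))
    (:- ξ₂-polynomial (var zero) (var (suc zero)) (var (suc (suc zero)))) refl

-- Counting co-degrees

module Codegrees where

  import Data.Bool as Bool
  open import Data.Bool using (true; false; if_then_else_; _∧_)
  open import Data.Empty using (⊥-elim)
  open import Data.Fin using (Fin; zero; suc; _↑ˡ_; _↑ʳ_)
  open import Data.Fin.Subset
    using (Subset; inside; outside; _∈_; _⊆_; _∩_; _∪_; ⁅_⁆; ∣_∣; Nonempty; ⊤; ⊥)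
  open import Data.Fin.Subset.Properties
  open import Data.List as List using ([]; _∷_; _++_; map; filter; length)
  open import Data.List.Properties using (filter-≐; filter-none; filter-++; length-++)
  open import Data.List.Relation.Unary.All using (universal)
  open import Data.Nat as ℕ using (ℕ; zero; suc; _+_; _*_; _<_; z≤n; s≤s)
  import Data.Nat.Properties as ℕₚ
  open import Data.Nat.Properties
    using (suc-injective; +-suc; +-identityʳ; *-identityˡ; *-identityʳ; *-distribʳ-+; *-zeroʳ)
  open import Data.Nat.Tactic.RingSolver using (solve-∀)
  open import Data.Product using (_×_; _,_; proj₁; proj₂; ∃)
  open import Data.Sum as Sum using (_⊎_; inj₁; inj₂)
  open import Data.Vec as Vec using ([]; _∷_; lookup)
  import Data.Vec.Properties as Vecₚ
  open import Function using (_∘_; _⇔_; mk⇔; Equivalence)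
  open import Relation.Binary.PropositionalEquality
  open import Relation.Nullary using (¬_; yes; no; does)
  open import Relation.Nullary.Decidable using (_×-dec_; map′)
  open import Relation.Unary using (Pred; Decidable)
  open Equivalence using (to; from)

  private
    variable
      m n : ℕ
      p : Subset n

  length-filter-⊎ : ∀ {a p q r} {A : Set a} {P : Pred A p} {Q : Pred A q} {R : Pred A r}
    (P? : Decidable P) (Q? : Decidable Q) (R? : Decidable R) →
    (∀ x → P x ⇔ (Q x ⊎ R x)) → (∀ x → Q x → ¬ R x) → ∀ xs →
    length (filter P? xs) ≡ length (filter Q? xs) + length (filter R? xs)
  length-filter-⊎ P? Q? R? P⇔Q⊎R disjoint [] = refl
  length-filter-⊎ P? Q? R? P⇔Q⊎R disjoint (x ∷ xs)
    with ih ← length-filter-⊎ P? Q? R? P⇔Q⊎R disjoint xs | P? x | Q? x | R? x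
  ... | _      | yes q | yes r = ⊥-elim (disjoint x q r)
  ... | yes _  | yes _ | no _  = cong suc ih
  ... | yes _  | no _  | yes _ = trans (cong suc ih) (sym (+-suc _ _))
  ... | yes Px | no ¬q | no ¬r = ⊥-elim (Sum.[ ¬q , ¬r ] (to (P⇔Q⊎R x) Px))
  ... | no ¬p  | yes q | no _  = ⊥-elim (¬p (from (P⇔Q⊎R x) (inj₁ q)))
  ... | no ¬p  | no _  | yes r = ⊥-elim (¬p (from (P⇔Q⊎R x) (inj₂ r)))
  ... | no _   | no _  | no _  = ih

  length-filter-map : ∀ {a b p} {A : Set a} {B : Set b} {P : Pred B p} (P? : Decidable P) (f : A → B) xs →
    length (filter P? (map f xs)) ≡ length (filter (P? ∘ f) xs)
  length-filter-map P? f []       = refl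
  length-filter-map P? f (x ∷ xs) with does (P? (f x))
  ... | true  = cong suc (length-filter-map P? f xs)
  ... | false = length-filter-map P? f xs

  count : {P : Subset n → Set} → Decidable P → ℕ
  count {n} P? = length (filter P? (subsets n))

  count-cong : {P Q : Subset n → Set} (P? : Decidable P) (Q? : Decidable Q) →
    (∀ f → P f ⇔ Q f) → count P? ≡ count Q?
  count-cong {n} P? Q? P⇔Q = cong length
    (filter-≐ P? Q? ((λ {f} → to (P⇔Q f)) , (λ {f} → from (P⇔Q f))) (subsets n))

  count-none : {P : Subset n → Set} (P? : Decidable P) → (∀ f → ¬ P f) → count P? ≡ 0
  count-none {n} P? ¬P = cong length (filter-none P? (universal ¬P (subsets n)))

  count-∷ : {P : Subset (suc n) → Set} (P? : Decidable P) →
    count P? ≡ count (P? ∘ (inside ∷_)) + count (P? ∘ (outside ∷_))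
  count-∷ {n} P? = begin
    length (filter P? (map (inside ∷_) (subsets n) ++ map (outside ∷_) (subsets n)))
      ≡⟨ cong length (filter-++ P? (map (inside ∷_) (subsets n)) _) ⟩
    length (filter P? (map (inside ∷_) (subsets n)) ++ filter P? (map (outside ∷_) (subsets n)))
      ≡⟨ length-++ (filter P? (map (inside ∷_) (subsets n))) ⟩
    length (filter P? (map (inside ∷_) (subsets n))) + length (filter P? (map (outside ∷_) (subsets n)))
      ≡⟨ cong₂ _+_ (length-filter-map P? (inside ∷_) (subsets n)) (length-filter-map P? (outside ∷_) (subsets n)) ⟩
    count (P? ∘ (inside ∷_)) + count (P? ∘ (outside ∷_)) ∎
    where open ≡-Reasoning

  count-++ : ∀ m {P : Subset (m + n) → Set} {Q : Subset m → Set} {R : Subset n → Set}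
    (P? : Decidable P) (Q? : Decidable Q) (R? : Decidable R) →
    (∀ f g → P (f Vec.++ g) ⇔ (Q f × R g)) → count P? ≡ count Q? * count R?
  count-++ zero P? Q? R? P⇔Q×R with Q? []
  ... | yes Q[] = trans (count-cong P? R? λ g → mk⇔ (proj₂ ∘ to (P⇔Q×R [] g)) (λ r → from (P⇔Q×R [] g) (Q[] , r)))
                        (sym (+-identityʳ _))
  ... | no ¬Q[] = count-none P? λ g → ¬Q[] ∘ proj₁ ∘ to (P⇔Q×R [] g)
  count-++ (suc m) P? Q? R? P⇔Q×R = begin
    count P?
      ≡⟨ count-∷ P? ⟩
    count (P? ∘ (inside ∷_)) + count (P? ∘ (outside ∷_))
      ≡⟨ cong₂ _+_ (count-++ m (P? ∘ (inside ∷_)) (Q? ∘ (inside ∷_)) R? λ f → P⇔Q×R (inside ∷ f))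
                   (count-++ m (P? ∘ (outside ∷_)) (Q? ∘ (outside ∷_)) R? λ f → P⇔Q×R (outside ∷ f)) ⟩
    count (Q? ∘ (inside ∷_)) * count R? + count (Q? ∘ (outside ∷_)) * count R?
      ≡⟨ *-distribʳ-+ (count R?) (count (Q? ∘ (inside ∷_))) _ ⟨
    (count (Q? ∘ (inside ∷_)) + count (Q? ∘ (outside ∷_))) * count R?
      ≡⟨ cong (_* count R?) (count-∷ Q?) ⟨
    count Q? * count R? ∎
    where open ≡-Reasoning

  count-≡ : ∀ (e : Subset n) → count (λ f → Vecₚ.≡-dec Bool._≟_ f e) ≡ 1
  count-≡ []            = refl
  count-≡ (inside ∷ e)  = trans (count-∷ {_} {_≡ inside ∷ e} _) (cong₂ _+_
    (trans (count-cong _ (λ f → Vecₚ.≡-dec Bool._≟_ f e) λ f → mk⇔ Vecₚ.∷-injectiveʳ (cong (inside ∷_))) (count-≡ e))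
    (count-none {P = λ f → outside ∷ f ≡ inside ∷ e} _ λ f ()))
  count-≡ (outside ∷ e) = trans (count-∷ {_} {_≡ outside ∷ e} _) (cong₂ _+_
    (count-none {P = λ f → inside ∷ f ≡ outside ∷ e} _ λ f ())
    (trans (count-cong _ (λ f → Vecₚ.≡-dec Bool._≟_ f e) λ f → mk⇔ Vecₚ.∷-injectiveʳ (cong (outside ∷_))) (count-≡ e)))

  supersetOfSize? : ∀ (g : Subset n) s → Decidable (λ f → ∣ f ∣ ≡ s × g ⊆ f)
  supersetOfSize? g s f = (∣ f ∣ ℕ.≟ s) ×-dec (g ⊆? f)

  -- A binomial coefficient. Since two of the three vertices of a hyperedge are prescribed, it is
  -- evaluated only where `s` exceeds `∣ g ∣` by at most one; any other count is multiplied by zero.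
  supersets : Subset n → ℕ → ℕ
  supersets g s = count (supersetOfSize? g s)

  supersets-< : ∀ (g : Subset n) s → s < ∣ g ∣ → supersets g s ≡ 0
  supersets-< g s s<∣g∣ = count-none (supersetOfSize? g s) λ { f (refl , g⊆f) → ℕₚ.<⇒≱ s<∣g∣ (p⊆q⇒∣p∣≤∣q∣ g⊆f) }

  supersets-inside : ∀ (g : Subset n) s → supersets (inside ∷ g) (suc s) ≡ supersets g s
  supersets-inside g s = trans (count-∷ (supersetOfSize? (inside ∷ g) (suc s))) (trans (cong₂ _+_
    (count-cong _ (supersetOfSize? g s) λ f → mk⇔
      (λ { (size , g⊆f) → suc-injective size , drop-∷-⊆ g⊆f })
      (λ { (size , g⊆f) → cong suc size , s⊆s g⊆f }))
    (count-none {P = λ f → ∣ outside ∷ f ∣ ≡ suc s × inside ∷ g ⊆ outside ∷ f} _ λ { f (_ , g⊆f) → outside∌ (g⊆f Vec.here) }))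
    (+-identityʳ _))
    where
    outside∌ : ∀ {n} {f : Subset n} → ¬ zero ∈ outside ∷ f
    outside∌ ()

  -- Pascal's rule: the superset either takes the head or leaves it out.
  supersets-outside : ∀ (g : Subset n) s →
    supersets (outside ∷ g) (suc s) ≡ supersets g s + supersets g (suc s)
  supersets-outside g s = trans (count-∷ (supersetOfSize? (outside ∷ g) (suc s))) (cong₂ _+_
    (count-cong _ (supersetOfSize? g s) λ f → mk⇔
      (λ { (size , g⊆f) → suc-injective size , drop-∷-⊆ g⊆f })
      (λ { (size , g⊆f) → cong suc size , out⊆ g⊆f }))
    (count-cong _ (supersetOfSize? g (suc s)) λ f → mk⇔
      (λ { (size , g⊆f) → size , drop-∷-⊆ g⊆f })
      (λ { (size , g⊆f) → size , out⊆ g⊆f })))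

  ⊆-∣∣-≡ : ∀ {g f : Subset n} → g ⊆ f → ∣ f ∣ ≡ ∣ g ∣ → f ≡ g
  ⊆-∣∣-≡ {g = []}          {[]}          g⊆f size = refl
  ⊆-∣∣-≡ {g = inside ∷ g}  {inside ∷ f}  g⊆f size = cong (inside ∷_) (⊆-∣∣-≡ (drop-∷-⊆ g⊆f) (suc-injective size))
  ⊆-∣∣-≡ {g = outside ∷ g} {outside ∷ f} g⊆f size = cong (outside ∷_) (⊆-∣∣-≡ (drop-∷-⊆ g⊆f) size)
  ⊆-∣∣-≡ {g = outside ∷ g} {inside ∷ f}  g⊆f size = ⊥-elim (ℕₚ.<⇒≱ (ℕₚ.≤-reflexive size) (p⊆q⇒∣p∣≤∣q∣ (drop-∷-⊆ g⊆f)))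
  ⊆-∣∣-≡ {g = inside ∷ g}  {outside ∷ f} g⊆f size with () ← g⊆f Vec.here

  supersets-self : ∀ (g : Subset n) → supersets g ∣ g ∣ ≡ 1
  supersets-self g = trans
    (count-cong _ (λ f → Vecₚ.≡-dec Bool._≟_ f g) λ f → mk⇔
      (λ { (size , g⊆f) → ⊆-∣∣-≡ g⊆f size })
      (λ { refl → refl , λ x∈g → x∈g }))
    (count-≡ g)

  -- The additional element is any one outside `g`; the sum form avoids truncated subtraction. If
  -- the head is outside `g`, exactly one superset takes it, namely `g` with the head added.
  supersets-suc : ∀ (g : Subset n) → ∣ g ∣ + supersets g (suc ∣ g ∣) ≡ n
  supersets-suc []            = refl
  supersets-suc (inside ∷ g)  = cong suc (trans (cong (∣ g ∣ +_) (supersets-inside g (suc ∣ g ∣))) (supersets-suc g))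
  supersets-suc (outside ∷ g) = begin
    ∣ g ∣ + supersets (outside ∷ g) (suc ∣ g ∣)
      ≡⟨ cong (∣ g ∣ +_) (supersets-outside g ∣ g ∣) ⟩
    ∣ g ∣ + (supersets g ∣ g ∣ + supersets g (suc ∣ g ∣))
      ≡⟨ cong (λ c → ∣ g ∣ + (c + supersets g (suc ∣ g ∣))) (supersets-self g) ⟩
    ∣ g ∣ + suc (supersets g (suc ∣ g ∣))
      ≡⟨ trans (+-suc ∣ g ∣ _) (cong suc (supersets-suc g)) ⟩
    suc _ ∎
    where open ≡-Reasoning

  ∣++∣ : ∀ (p : Subset m) (q : Subset n) → ∣ p Vec.++ q ∣ ≡ ∣ p ∣ + ∣ q ∣
  ∣++∣ []            q = refl
  ∣++∣ (inside ∷ p)  q = cong suc (∣++∣ p q)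
  ∣++∣ (outside ∷ p) q = ∣++∣ p q

  ∣∩V₁∣ : ∀ (p : Subset m) (q : Subset n) → ∣ (p Vec.++ q) ∩ V₁ m n ∣ ≡ ∣ p ∣
  ∣∩V₁∣ {m} {n} p q = begin
    ∣ (p Vec.++ q) ∩ (⊤ {m} Vec.++ ⊥ {n}) ∣   ≡⟨ cong ∣_∣ (Vecₚ.zipWith-++ Bool._∧_ p q ⊤ ⊥) ⟩
    ∣ (p ∩ ⊤) Vec.++ (q ∩ ⊥) ∣        ≡⟨ ∣++∣ (p ∩ ⊤) (q ∩ ⊥) ⟩
    ∣ p ∩ ⊤ ∣ + ∣ q ∩ ⊥ ∣             ≡⟨ cong₂ _+_ (cong ∣_∣ (∩-identityʳ p)) (cong ∣_∣ (∩-zeroʳ q)) ⟩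
    ∣ p ∣ + ∣ ⊥ {n} ∣                 ≡⟨ trans (cong (∣ p ∣ +_) (∣⊥∣≡0 n)) (+-identityʳ _) ⟩
    ∣ p ∣                             ∎
    where open ≡-Reasoning

  ∣∩V₂∣ : ∀ (p : Subset m) (q : Subset n) → ∣ (p Vec.++ q) ∩ V₂ m n ∣ ≡ ∣ q ∣
  ∣∩V₂∣ {m} {n} p q = begin
    ∣ (p Vec.++ q) ∩ (⊥ {m} Vec.++ ⊤ {n}) ∣   ≡⟨ cong ∣_∣ (Vecₚ.zipWith-++ Bool._∧_ p q ⊥ ⊤) ⟩
    ∣ (p ∩ ⊥) Vec.++ (q ∩ ⊤) ∣        ≡⟨ ∣++∣ (p ∩ ⊥) (q ∩ ⊤) ⟩
    ∣ p ∩ ⊥ ∣ + ∣ q ∩ ⊤ ∣             ≡⟨ cong₂ _+_ (cong ∣_∣ (∩-zeroʳ p)) (cong ∣_∣ (∩-identityʳ q)) ⟩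
    ∣ ⊥ {m} ∣ + ∣ q ∣                 ≡⟨ cong (_+ ∣ q ∣) (∣⊥∣≡0 m) ⟩
    ∣ q ∣                             ∎
    where open ≡-Reasoning

  Nonempty⇔0<∣∣ : Nonempty p ⇔ 0 < ∣ p ∣
  Nonempty⇔0<∣∣ {p = p} = mk⇔ (λ { (x , x∈p) → ℕₚ.m<n⇒0<n (x∈p⇒∣p-x∣<∣p∣ x∈p) }) back
    where
    back : ∀ {n} {p : Subset n} → 0 < ∣ p ∣ → Nonempty p
    back {p = inside ∷ p}  _   = zero , Vec.here
    back {p = outside ∷ p} 0<p = let x , x∈p = back 0<p in suc x , Vec.there x∈p

  completeBipartite³-edge : ∀ (p : Subset m) (q : Subset n) → IsEdge (completeBipartite³ m n) (p Vec.++ q) ⇔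
    ((∣ p ∣ ≡ 1 × ∣ q ∣ ≡ 2) ⊎ (∣ p ∣ ≡ 2 × ∣ q ∣ ≡ 1))
  completeBipartite³-edge p q = mk⇔ split join
    where
    sizes : ∀ a b → a + b ≡ 3 → 0 < a → 0 < b → (a ≡ 1 × b ≡ 2) ⊎ (a ≡ 2 × b ≡ 1)
    sizes 1 2 refl _ _ = inj₁ (refl , refl)
    sizes 2 1 refl _ _ = inj₂ (refl , refl)
    sizes 3 0 refl _ ()

    split : _ → _
    split (size , meets₁ , meets₂) = sizes ∣ p ∣ ∣ q ∣ (trans (sym (∣++∣ p q)) size)
      (subst (0 <_) (∣∩V₁∣ p q) (to Nonempty⇔0<∣∣ meets₁))
      (subst (0 <_) (∣∩V₂∣ p q) (to Nonempty⇔0<∣∣ meets₂))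

    join : _ → _
    join sizes = trans (∣++∣ p q) (total sizes)
               , from Nonempty⇔0<∣∣ (subst (0 <_) (sym (∣∩V₁∣ p q)) (positive₁ sizes))
               , from Nonempty⇔0<∣∣ (subst (0 <_) (sym (∣∩V₂∣ p q)) (positive₂ sizes))
      where
      total : ∀ {a b} → (a ≡ 1 × b ≡ 2) ⊎ (a ≡ 2 × b ≡ 1) → a + b ≡ 3
      total (inj₁ (refl , refl)) = refl
      total (inj₂ (refl , refl)) = refl
      positive₁ : ∀ {a b} → (a ≡ 1 × b ≡ 2) ⊎ (a ≡ 2 × b ≡ 1) → 0 < a
      positive₁ (inj₁ (refl , refl)) = s≤s z≤n
      positive₁ (inj₂ (refl , refl)) = s≤s z≤n
      positive₂ : ∀ {a b} → (a ≡ 1 × b ≡ 2) ⊎ (a ≡ 2 × b ≡ 1) → 0 < b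
      positive₂ (inj₁ (refl , refl)) = s≤s z≤n
      positive₂ (inj₂ (refl , refl)) = s≤s z≤n

  -- A hyperedge meets the parts in 1 + 2 or 2 + 1 vertices, and each kind is counted as a product
  -- over the parts. `g` and `h` record what `i` and `j` force in each part, so that all positions
  -- of the two vertices are treated alike.
  codegree-supersets : ∀ (i j : Fin (m + n)) (g : Subset m) (h : Subset n) →
    (∀ p q → (i ∈ p Vec.++ q × j ∈ p Vec.++ q) ⇔ (g ⊆ p × h ⊆ q)) →
    codegree (completeBipartite³ m n) i j ≡
    supersets g 1 * supersets h 2 + supersets g 2 * supersets h 1
  codegree-supersets {m} {n} i j g h contains = trans
    (length-filter-⊎ {P = λ f → IsEdge (completeBipartite³ m n) f × i ∈ f × j ∈ f} _ (withSizes? 1 2) (withSizes? 2 1) splits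
      (λ { f (p , q , refl , (p1 , _) , _) (p′ , q′ , eq , (p2 , _) , _) → disjoint p p′ p1 p2 (Vecₚ.++-injectiveˡ p p′ eq) })
      (subsets (m + n)))
    (cong₂ _+_ (count-++ m (withSizes? 1 2) (supersetOfSize? g 1) (supersetOfSize? h 2) (product 1 2))
               (count-++ m (withSizes? 2 1) (supersetOfSize? g 2) (supersetOfSize? h 1) (product 2 1)))
    where
    WithSizes : ℕ → ℕ → Subset (m + n) → Set
    WithSizes s t f = ∃ λ p → ∃ λ q → f ≡ p Vec.++ q × (∣ p ∣ ≡ s × g ⊆ p) × (∣ q ∣ ≡ t × h ⊆ q)

    withSizes? : ∀ s t → Decidable (WithSizes s t)
    withSizes? s t f with p , q , refl ← Vec.splitAt m f =
      map′ (λ { (sp , sq) → p , q , refl , sp , sq })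
           (λ { (p′ , q′ , eq , sp , sq) → subst (λ p → ∣ p ∣ ≡ s × g ⊆ p) (sym (Vecₚ.++-injectiveˡ p p′ eq)) sp
                                         , subst (λ q → ∣ q ∣ ≡ t × h ⊆ q) (sym (Vecₚ.++-injectiveʳ p p′ eq)) sq })
           (supersetOfSize? g s p ×-dec supersetOfSize? h t q)

    product : ∀ s t p q → WithSizes s t (p Vec.++ q) ⇔ ((∣ p ∣ ≡ s × g ⊆ p) × (∣ q ∣ ≡ t × h ⊆ q))
    product s t p q = mk⇔
      (λ { (p′ , q′ , eq , sp , sq) → subst (λ p → ∣ p ∣ ≡ s × g ⊆ p) (sym (Vecₚ.++-injectiveˡ p p′ eq)) sp
                                    , subst (λ q → ∣ q ∣ ≡ t × h ⊆ q) (sym (Vecₚ.++-injectiveʳ p p′ eq)) sq })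
      (λ { (sp , sq) → p , q , refl , sp , sq })

    disjoint : ∀ (p p′ : Subset m) → ∣ p ∣ ≡ 1 → ∣ p′ ∣ ≡ 2 → ¬ p ≡ p′
    disjoint p p′ p1 p2 refl with () ← trans (sym p1) p2

    splits : ∀ f → (IsEdge (completeBipartite³ m n) f × i ∈ f × j ∈ f) ⇔ (WithSizes 1 2 f ⊎ WithSizes 2 1 f)
    splits f with p , q , refl ← Vec.splitAt m f = mk⇔
      (λ { (edge , ij∈f) → let g⊆p , h⊆q = to (contains p q) ij∈f in
           Sum.map (λ { (s , t) → p , q , refl , (s , λ {_} → g⊆p) , (t , λ {_} → h⊆q) })
                   (λ { (s , t) → p , q , refl , (s , λ {_} → g⊆p) , (t , λ {_} → h⊆q) })
                   (to (completeBipartite³-edge p q) edge) })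
      Sum.[ (λ w → let (s , g⊆p) , (t , h⊆q) = to (product 1 2 p q) w in
              from (completeBipartite³-edge p q) (inj₁ (s , t)) , from (contains p q) ((λ {_} → g⊆p) , (λ {_} → h⊆q)))
          , (λ w → let (s , g⊆p) , (t , h⊆q) = to (product 2 1 p q) w in
              from (completeBipartite³-edge p q) (inj₂ (s , t)) , from (contains p q) ((λ {_} → g⊆p) , (λ {_} → h⊆q))) ]

  ∈-↑ˡ : ∀ (p : Subset m) (q : Subset n) {a} → (a ↑ˡ n ∈ p Vec.++ q) ⇔ a ∈ p
  ∈-↑ˡ p q {a} = mk⇔
    (λ a∈ → Vecₚ.lookup⇒[]= a p (trans (sym (Vecₚ.lookup-++ˡ p q a)) (Vecₚ.[]=⇒lookup a∈)))
    (λ a∈ → Vecₚ.lookup⇒[]= _ (p Vec.++ q) (trans (Vecₚ.lookup-++ˡ p q a) (Vecₚ.[]=⇒lookup a∈)))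

  ∈-↑ʳ : ∀ (p : Subset m) (q : Subset n) {b} → (m ↑ʳ b ∈ p Vec.++ q) ⇔ b ∈ q
  ∈-↑ʳ p q {b} = mk⇔
    (λ b∈ → Vecₚ.lookup⇒[]= b q (trans (sym (Vecₚ.lookup-++ʳ p q b)) (Vecₚ.[]=⇒lookup b∈)))
    (λ b∈ → Vecₚ.lookup⇒[]= _ (p Vec.++ q) (trans (Vecₚ.lookup-++ʳ p q b) (Vecₚ.[]=⇒lookup b∈)))

  ⁅⁆⊆ : ∀ {x : Fin n} → x ∈ p → ⁅ x ⁆ ⊆ p
  ⁅⁆⊆ x∈p y∈ with refl ← x∈⁅y⁆⇒x≡y _ y∈ = x∈p

  pair⊆ : ∀ {x y : Fin n} → (x ∈ p × y ∈ p) ⇔ ⁅ x ⁆ ∪ ⁅ y ⁆ ⊆ p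
  pair⊆ {x = x} {y} = mk⇔
    (λ { (x∈p , y∈p) z∈ → Sum.[ ⁅⁆⊆ x∈p , ⁅⁆⊆ y∈p ] (x∈p∪q⁻ ⁅ x ⁆ ⁅ y ⁆ z∈) })
    (λ xy⊆p → xy⊆p (x∈p∪q⁺ (inj₁ (x∈⁅x⁆ x))) , xy⊆p (x∈p∪q⁺ (inj₂ (x∈⁅x⁆ y))))

  ∣pair∣ : ∀ (x y : Fin n) → x ≢ y → ∣ ⁅ x ⁆ ∪ ⁅ y ⁆ ∣ ≡ 2
  ∣pair∣ zero    zero    x≢y = ⊥-elim (x≢y refl)
  ∣pair∣ zero    (suc y) x≢y = cong suc (trans (cong ∣_∣ (∪-identityˡ ⁅ y ⁆)) (∣⁅x⁆∣≡1 y))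
  ∣pair∣ (suc x) zero    x≢y = cong suc (trans (cong ∣_∣ (∪-identityʳ ⁅ x ⁆)) (∣⁅x⁆∣≡1 x))
  ∣pair∣ (suc x) (suc y) x≢y = ∣pair∣ x y (x≢y ∘ cong suc)

  supersets-of-size : ∀ (g : Subset n) {s} → ∣ g ∣ ≡ s → supersets g s ≡ 1
  supersets-of-size g refl = supersets-self g

  supersets-of-next-size : ∀ (g : Subset n) {s} → ∣ g ∣ ≡ s → s + supersets g (suc s) ≡ n
  supersets-of-next-size g refl = supersets-suc g

  codegree-V₁V₁ : ∀ (a b : Fin m) → a ≢ b → codegree (completeBipartite³ m n) (a ↑ˡ n) (b ↑ˡ n) ≡ n
  codegree-V₁V₁ {m} {n} a b a≢b = begin
    codegree (completeBipartite³ m n) (a ↑ˡ n) (b ↑ˡ n)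
      ≡⟨ codegree-supersets (a ↑ˡ n) (b ↑ˡ n) g ⊥ (λ p q → mk⇔
           (λ { (a∈ , b∈) → (λ {_} → to pair⊆ (to (∈-↑ˡ p q) a∈ , to (∈-↑ˡ p q) b∈)) , λ {_} → ⊥⊆ })
           (λ { (g⊆p , _) → let a∈ , b∈ = from pair⊆ g⊆p in from (∈-↑ˡ p q) a∈ , from (∈-↑ˡ p q) b∈ })) ⟩
    supersets g 1 * supersets (⊥ {n}) 2 + supersets g 2 * supersets (⊥ {n}) 1
      ≡⟨ cong₂ (λ x y → x * supersets (⊥ {n}) 2 + y * supersets (⊥ {n}) 1)
           (supersets-< g 1 (ℕₚ.≤-reflexive (sym ∣g∣))) (supersets-of-size g ∣g∣) ⟩
    1 * supersets (⊥ {n}) 1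
      ≡⟨ trans (*-identityˡ _) (supersets-of-next-size (⊥ {n}) (∣⊥∣≡0 n)) ⟩
    n ∎
    where
    open ≡-Reasoning
    g = ⁅ a ⁆ ∪ ⁅ b ⁆
    ∣g∣ = ∣pair∣ a b a≢b

  codegree-V₂V₂ : ∀ (a b : Fin n) → a ≢ b → codegree (completeBipartite³ m n) (m ↑ʳ a) (m ↑ʳ b) ≡ m
  codegree-V₂V₂ {n} {m} a b a≢b = begin
    codegree (completeBipartite³ m n) (m ↑ʳ a) (m ↑ʳ b)
      ≡⟨ codegree-supersets (m ↑ʳ a) (m ↑ʳ b) ⊥ h (λ p q → mk⇔
           (λ { (a∈ , b∈) → (λ {_} → ⊥⊆) , λ {_} → to pair⊆ (to (∈-↑ʳ p q) a∈ , to (∈-↑ʳ p q) b∈) })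
           (λ { (_ , h⊆q) → let a∈ , b∈ = from pair⊆ h⊆q in from (∈-↑ʳ p q) a∈ , from (∈-↑ʳ p q) b∈ })) ⟩
    supersets (⊥ {m}) 1 * supersets h 2 + supersets (⊥ {m}) 2 * supersets h 1
      ≡⟨ cong₂ (λ x y → supersets (⊥ {m}) 1 * x + supersets (⊥ {m}) 2 * y)
           (supersets-of-size h ∣h∣) (supersets-< h 1 (ℕₚ.≤-reflexive (sym ∣h∣))) ⟩
    supersets (⊥ {m}) 1 * 1 + supersets (⊥ {m}) 2 * 0
      ≡⟨ cong₂ _+_ (*-identityʳ _) (*-zeroʳ (supersets (⊥ {m}) 2)) ⟩
    supersets (⊥ {m}) 1 + 0
      ≡⟨ trans (+-identityʳ _) (supersets-of-next-size (⊥ {m}) (∣⊥∣≡0 m)) ⟩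
    m ∎
    where
    open ≡-Reasoning
    h = ⁅ a ⁆ ∪ ⁅ b ⁆
    ∣h∣ = ∣pair∣ a b a≢b

  -- Stated without the truncated subtraction m + n ∸ 2.
  codegree-V₁V₂ : ∀ (a : Fin m) (b : Fin n) → 2 + codegree (completeBipartite³ m n) (a ↑ˡ n) (m ↑ʳ b) ≡ m + n
  codegree-V₁V₂ {m} {n} a b = begin
    2 + codegree (completeBipartite³ m n) (a ↑ˡ n) (m ↑ʳ b)
      ≡⟨ cong (2 +_) (codegree-supersets (a ↑ˡ n) (m ↑ʳ b) ⁅ a ⁆ ⁅ b ⁆ (λ p q → mk⇔
           (λ { (a∈ , b∈) → (λ {_} → ⁅⁆⊆ (to (∈-↑ˡ p q) a∈)) , λ {_} → ⁅⁆⊆ (to (∈-↑ʳ p q) b∈) })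
           (λ { (g⊆p , h⊆q) → from (∈-↑ˡ p q) (g⊆p (x∈⁅x⁆ a)) , from (∈-↑ʳ p q) (h⊆q (x∈⁅x⁆ b)) }))) ⟩
    2 + (supersets ⁅ a ⁆ 1 * supersets ⁅ b ⁆ 2 + supersets ⁅ a ⁆ 2 * supersets ⁅ b ⁆ 1)
      ≡⟨ cong₂ (λ x y → 2 + (x * supersets ⁅ b ⁆ 2 + supersets ⁅ a ⁆ 2 * y))
           (supersets-of-size ⁅ a ⁆ (∣⁅x⁆∣≡1 a)) (supersets-of-size ⁅ b ⁆ (∣⁅x⁆∣≡1 b)) ⟩
    2 + (1 * supersets ⁅ b ⁆ 2 + supersets ⁅ a ⁆ 2 * 1)
      ≡⟨ rearrange (supersets ⁅ a ⁆ 2) (supersets ⁅ b ⁆ 2) ⟩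
    suc (supersets ⁅ a ⁆ 2) + suc (supersets ⁅ b ⁆ 2)
      ≡⟨ cong₂ _+_ (supersets-of-next-size ⁅ a ⁆ (∣⁅x⁆∣≡1 a)) (supersets-of-next-size ⁅ b ⁆ (∣⁅x⁆∣≡1 b)) ⟩
    m + n ∎
    where
    open ≡-Reasoning
    rearrange : ∀ x y → 2 + (1 * y + x * 1) ≡ suc x + suc y
    rearrange = solve-∀

  codegree-sym : ∀ (H : Hypergraph n) i j → codegree H i j ≡ codegree H j i
  codegree-sym {n} H i j = count-cong {n}
    (λ f → isEdge? H f ×-dec (i ∈? f) ×-dec (j ∈? f)) (λ f → isEdge? H f ×-dec (j ∈? f) ×-dec (i ∈? f)) λ f → mk⇔
    (λ { (edge , i∈ , j∈) → edge , j∈ , i∈ }) (λ { (edge , j∈ , i∈) → edge , i∈ , j∈ })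

  -- The hyperedges counted in `H` are those that survive and, if it contains both vertices, `e`
  -- itself. A sum again replaces truncated subtraction.
  codegree-∖ᵉ : ∀ (H : Hypergraph n) e → IsEdge H e → ∀ i j →
    codegree H i j ≡ codegree (H ∖ᵉ e) i j + (if lookup e i ∧ lookup e j then 1 else 0)
  codegree-∖ᵉ {n} H e edge i j = trans
    (length-filter-⊎ _ (λ f → isEdge? (H ∖ᵉ e) f ×-dec (i ∈? f) ×-dec (j ∈? f)) removed?
      (λ f → mk⇔ (separate f)
        Sum.[ (λ { ((He , _) , ij∈f) → He , ij∈f }) , (λ { (refl , ij∈e) → edge , ij∈e }) ])
      (λ { f ((_ , f≢e) , _) (f≡e , _) → f≢e f≡e }) (subsets n))
    (cong (codegree (H ∖ᵉ e) i j +_) removed)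
    where
    removed? : Decidable (λ f → f ≡ e × i ∈ e × j ∈ e)
    removed? f = Vecₚ.≡-dec Bool._≟_ f e ×-dec (i ∈? e) ×-dec (j ∈? e)

    separate : ∀ f → IsEdge H f × i ∈ f × j ∈ f →
      (IsEdge (H ∖ᵉ e) f × i ∈ f × j ∈ f) ⊎ (f ≡ e × i ∈ e × j ∈ e)
    separate f (He , ij∈f) with Vecₚ.≡-dec Bool._≟_ f e
    ... | yes refl = inj₂ (refl , ij∈f)
    ... | no f≢e   = inj₁ ((He , f≢e) , ij∈f)

    removed : count removed? ≡ (if lookup e i ∧ lookup e j then 1 else 0)
    removed with lookup e i in i∈ | lookup e j in j∈
    ... | true  | true  = trans
      (count-cong _ (λ f → Vecₚ.≡-dec Bool._≟_ f e) λ f → mk⇔ proj₁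
        (λ f≡e → f≡e , Vecₚ.lookup⇒[]= i e i∈ , Vecₚ.lookup⇒[]= j e j∈))
      (count-≡ e)
    ... | true  | false = count-none removed? λ { f (_ , _ , j∈e) → true≢false (trans (sym (Vecₚ.[]=⇒lookup j∈e)) j∈) }
      where true≢false : ¬ true ≡ false
            true≢false ()
    ... | false | _     = count-none removed? λ { f (_ , i∈e , _) → true≢false (trans (sym (Vecₚ.[]=⇒lookup i∈e)) i∈) }
      where true≢false : ¬ true ≡ false
            true≢false ()

-- The characteristic determinant over the integers

module SeidelDeterminant where

  open import Data.Bool using (true; false; if_then_else_; _∧_)
  open import Data.Empty using (⊥-elim)
  open import Data.Fin as Fin using (Fin; _↑ˡ_; _↑ʳ_)
  open import Data.Fin.Properties using (join-splitAt)
  open import Data.Fin.Subset using (Subset; ∣_∣)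
  open import Data.Fin.Subset.Properties using (∣p∣≤n)
  open import Data.Integer using (ℤ; +_; +-*-rawRing; _+_; _*_; -_; _-_; _^_)
  open import Data.Integer.Properties using (+-*-commutativeRing)
  open import Data.Integer.Tactic.RingSolver using (solve-∀)
  open import Data.List as List using (List; []; _∷_; replicate; _++_; lookup)
  open import Data.List.Properties using (map-++; map-replicate; ++-assoc)
  open import Data.List.Relation.Binary.Permutation.Propositional
    using (_↭_; ↭-refl; ↭-sym; ↭-trans; prep; ↭-reflexive)
  open import Data.List.Relation.Binary.Permutation.Propositional.Properties
    using (shift; map⁺; ++⁺; ++-comm)
  open import Data.Nat as ℕ using (ℕ; zero; suc)
  import Data.Nat.Properties as ℕₚ
  open import Data.Product using (_×_; _,_; proj₁; proj₂)
  open import Data.Sum using (inj₁; inj₂)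
  open import Data.Vec as Vec using (Vec; toList)
  import Data.Vec.Properties as Vecₚ
  open import Function using (_∘_; Equivalence)
  open import Relation.Binary.PropositionalEquality
  open import Relation.Nullary using (yes; no)

  open import Algebra.Definitions.RawMonoid (CommutativeRing.+-rawMonoid +-*-commutativeRing)
    using () renaming (_×_ to _⋆_)
  open import Algebra.Definitions.RawSemiring (Semiring.rawSemiring (CommutativeRing.semiring +-*-commutativeRing))
    using () renaming (_^_ to _^ᵣ_)
  open Determinant +-*-commutativeRing using (∣_∣ᵈ; ∣∣ᵈ-unfold; det-cong)
  open ClassDeterminant +-*-commutativeRing
  open Codegrees
  open QuotientDeterminant using (horner; reducedCharPoly-ξ₂)
  open VertexClasses
  open RawClassMatrix +-*-rawRing

  ⋆1≡ : ∀ k → k ⋆ + 1 ≡ + k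
  ⋆1≡ zero    = refl
  ⋆1≡ (suc k) = cong (λ z → + 1 + z) (⋆1≡ k)

  -- Sorting the membership vector forgets which vertices lie in `p`; this is where the spectrum
  -- becomes independent of the choice of `e`.
  toList-↭ : ∀ {n} (p : Subset n) k → ∣ p ∣ ℕ.+ k ≡ n →
    toList p ↭ replicate ∣ p ∣ true ++ replicate k false
  toList-↭ Vec.[]            zero    refl = ↭-refl
  toList-↭ (true Vec.∷ p)    k       eq   = prep true (toList-↭ p k (ℕₚ.suc-injective eq))
  toList-↭ (false Vec.∷ p)   zero    eq   =
    ⊥-elim (ℕₚ.1+n≰n (ℕₚ.≤-trans (ℕₚ.≤-reflexive (trans (sym eq) (ℕₚ.+-identityʳ _))) (∣p∣≤n p)))
  toList-↭ (false Vec.∷ p)   (suc k) eq   = ↭-trans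
    (prep false (toList-↭ p k (ℕₚ.suc-injective (trans (sym (ℕₚ.+-suc ∣ p ∣ k)) eq))))
    (↭-sym (shift false (replicate ∣ p ∣ true) (replicate k false)))

  sortedVertices : ℕ → ℕ → List (Class × ℤ)
  sortedVertices m′ n′ =
    replicate (suc m′) ((left , false) , + 1) ++ replicate 2 ((left , true) , + 1) ++
    replicate (suc n′) ((right , false) , + 1) ++ ((right , true) , + 1) ∷ []

  classDet-quotient : ∀ m n k →
    diagonal m n k (left , true) * classDet (diagonal m n k) (block m n) (quotient m n) ≡ - horner k (ξ₂ m n)
  classDet-quotient m n k = trans
    (cong (λ x → diagonal m n k (left , true) * x) (∣∣ᵈ-unfold (classMatrix (diagonal m n k) (block m n) (lookup (quotient m n)))))
    (reducedCharPoly-ξ₂ m n k)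

  -- The left side is `diagonal` at a class off `e`, written out: `x` is `n` for the left part and
  -- `m` for the right one, and `+ 0` is the indicator of the removed hyperedge.
  factor : ∀ k x → k + - ((+ 1 + + 1) * (x + - + 0) + - + 1) ≡ k - (+ 2 * x - + 1)
  factor = solve-∀

  power : ∀ x l → x ^ᵣ l ≡ x ^ l
  power x zero    = refl
  power x (suc l) = cong (x *_) (power x l)

  -- `a * + 1` is the first power left by the two left vertices on `e`. It is moved next to the
  -- quotient determinant `z`, because it is the product `a * z` that equals the quintic up to sign.
  combine : ∀ {x x′ y y′ a z w} k l → x ≡ x′ → y ≡ y′ → a * z ≡ w →
    x ^ᵣ k * ((a * + 1) * (y ^ᵣ l * z)) ≡ x′ ^ k * (y′ ^ l * w)
  combine {x} {y = y} {a = a} {z} k l refl refl refl = trans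
    (rearrange (x ^ᵣ k) a (y ^ᵣ l) z)
    (cong₂ (λ u v → u * (v * (a * z))) (power x k) (power y l))
    where
    rearrange : ∀ x a y z → x * ((a * + 1) * (y * z)) ≡ x * (y * (a * z))
    rearrange = solve-∀

  -- The two equations count the vertices of each part off `e`; they turn the weights obtained by
  -- merging into those of `quotient`.
  classDet-sorted : ∀ m n k m′ n′ → m + - (+ 2) ≡ + suc m′ → n + - (+ 1) ≡ + suc n′ →
    classDet (diagonal m n k) (block m n) (sortedVertices m′ n′) ≡
    (k - (+ 2 * n - + 1)) ^ m′ * ((k - (+ 2 * m - + 1)) ^ n′ * - horner k (ξ₂ m n))
  classDet-sorted m n k m′ n′ m-2≡ n-1≡ = trans
    (classDet-four d b B m′ A 1 D n′ C)
    (trans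
      (cong₂ (λ u v → d B ^ᵣ m′ * ((d A * + 1) * (d D ^ᵣ n′ * classDet d b ((C , + 1) ∷ (B , u) ∷ (A , + 2) ∷ (D , v) ∷ []))))
        (trans (⋆1≡ (suc m′)) (sym m-2≡)) (trans (⋆1≡ (suc n′)) (sym n-1≡)))
      (combine {a = d A} {classDet d b (quotient m n)} m′ n′ (factor k n) (factor k m) (classDet-quotient m n k)))
    where
    A B C D : Class
    A = left , true
    B = left , false
    C = right , true
    D = right , false
    d = diagonal m n k
    b = block m n

  module _ {m n : ℕ} (p : Subset m) (q : Subset n) (∣p∣≡2 : ∣ p ∣ ≡ 2) (∣q∣≡1 : ∣ q ∣ ≡ 1) where
    private
      H : Hypergraph (m ℕ.+ n)
      H = completeBipartite³ m n ∖ᵉ (p Vec.++ q)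

      vertices : Vec (Class × ℤ) (m ℕ.+ n)
      vertices = Vec.map (λ a → (left , a) , + 1) p Vec.++ Vec.map (λ b → (right , b) , + 1) q

      blockᶻ = block (+ m) (+ n)
      codeg = classCodegree (+ m) (+ n)

    -- A view of an index with its label, which turns `codegree-class` into a match on four cases.
    data Vertex : Fin (m ℕ.+ n) → Class × ℤ → Set where
      leftVertex  : ∀ a → Vertex (a ↑ˡ n) ((left , Vec.lookup p a) , + 1)
      rightVertex : ∀ b → Vertex (m ↑ʳ b) ((right , Vec.lookup q b) , + 1)

    vertex : ∀ i → Vertex i (Vec.lookup vertices i)
    vertex i = subst (λ i → Vertex i (Vec.lookup vertices i)) (join-splitAt m n i) (joined (Fin.splitAt m i))
      where
      joined : ∀ s → Vertex (Fin.join m n s) (Vec.lookup vertices (Fin.join m n s))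
      joined (inj₁ a) = subst (Vertex (a ↑ˡ n))
        (sym (trans (Vecₚ.lookup-++ˡ (Vec.map _ p) (Vec.map _ q) a) (Vecₚ.lookup-map a _ p))) (leftVertex a)
      joined (inj₂ b) = subst (Vertex (m ↑ʳ b))
        (sym (trans (Vecₚ.lookup-++ʳ (Vec.map _ p) (Vec.map _ q) b) (Vecₚ.lookup-map b _ q))) (rightVertex b)

    edge : IsEdge (completeBipartite³ m n) (p Vec.++ q)
    edge = Equivalence.from (completeBipartite³-edge p q) (inj₂ (∣p∣≡2 , ∣q∣≡1))

    codegree-removed : ∀ {i j a b} → Vec.lookup (p Vec.++ q) i ≡ a → Vec.lookup (p Vec.++ q) j ≡ b → ∀ {x} →
      + codegree (completeBipartite³ m n) i j ≡ x →
      + codegree H i j ≡ x + - (if a ∧ b then + 1 else + 0)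
    codegree-removed {i} {j} refl refl refl = begin
      + codegree H i j
        ≡⟨ cancel (+ codegree H i j) δ ⟩
      (+ codegree H i j + δ) + - δ
        ≡⟨ cong (λ c → (+ codegree H i j + c) + - δ) (if-+ (Vec.lookup (p Vec.++ q) i ∧ Vec.lookup (p Vec.++ q) j)) ⟨
      + (codegree H i j ℕ.+ (if Vec.lookup (p Vec.++ q) i ∧ Vec.lookup (p Vec.++ q) j then 1 else 0)) + - δ
        ≡⟨ cong (λ c → + c + - δ) (codegree-∖ᵉ (completeBipartite³ m n) (p Vec.++ q) edge i j) ⟨
      + codegree (completeBipartite³ m n) i j + - δ ∎
      where
      open ≡-Reasoning
      δ = if Vec.lookup (p Vec.++ q) i ∧ Vec.lookup (p Vec.++ q) j then + 1 else + 0
      if-+ : ∀ b → + (if b then 1 else 0) ≡ (if b then + 1 else + 0)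
      if-+ true  = refl
      if-+ false = refl
      cancel : ∀ x y → x ≡ (x + y) + - y
      cancel = solve-∀

    codegree-across : ∀ a b → + codegree (completeBipartite³ m n) (a ↑ˡ n) (m ↑ʳ b) ≡ (+ m + + n) + - (+ 1 + + 1)
    codegree-across a b = trans (cancel (+ codegree (completeBipartite³ m n) (a ↑ˡ n) (m ↑ʳ b)))
      (cong (λ c → + c + - (+ 1 + + 1)) (codegree-V₁V₂ {m} {n} a b))
      where
      cancel : ∀ x → x ≡ ((+ 1 + + 1) + x) + - (+ 1 + + 1)
      cancel = solve-∀

    codegree-class : ∀ {i j x y} → Vertex i x → Vertex j y → i ≢ j → + codegree H i j ≡ codeg (proj₁ x) (proj₁ y)
    codegree-class (leftVertex a) (leftVertex b) i≢j = codegree-removed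
      (Vecₚ.lookup-++ˡ p q a) (Vecₚ.lookup-++ˡ p q b) (cong +_ (codegree-V₁V₁ {m} {n} a b (i≢j ∘ cong (_↑ˡ n))))
    codegree-class (leftVertex a) (rightVertex b) i≢j = codegree-removed
      (Vecₚ.lookup-++ˡ p q a) (Vecₚ.lookup-++ʳ p q b) (codegree-across a b)
    codegree-class (rightVertex a) (leftVertex b) i≢j = codegree-removed
      (Vecₚ.lookup-++ʳ p q a) (Vecₚ.lookup-++ˡ p q b)
      (trans (cong +_ (codegree-sym (completeBipartite³ m n) (m ↑ʳ a) (b ↑ˡ n))) (codegree-across b a))
    codegree-class (rightVertex a) (rightVertex b) i≢j = codegree-removed
      (Vecₚ.lookup-++ʳ p q a) (Vecₚ.lookup-++ʳ p q b) (cong +_ (codegree-V₂V₂ {n} {m} a b (i≢j ∘ cong (m ↑ʳ_))))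

    weight≡1 : ∀ {i x} → Vertex i x → proj₂ x ≡ + 1
    weight≡1 (leftVertex a)  = refl
    weight≡1 (rightVertex b) = refl

    -- Off the diagonal this is the class formula for the co-degree. On the diagonal the formal
    -- block value, subtracted in `diagonal`, is added back with weight one.
    charMatrix-entry : ∀ k i j → onDiagonal i j k - seidel H i j ≡
      classMatrix (diagonal (+ m) (+ n) k) blockᶻ (Vec.lookup vertices) i j
    charMatrix-entry k i j with i Fin.≟ j
    ... | yes refl = trans (onDiag k (blockᶻ c c))
      (cong (λ w → (k + - blockᶻ c c) + w * blockᶻ c c) (sym (weight≡1 (vertex i))))
      where
      c = proj₁ (Vec.lookup vertices i)
      onDiag : ∀ k b → k - + 0 ≡ (k + - b) + + 1 * b
      onDiag = solve-∀
    ... | no i≢j = trans (cong (λ x → + 0 - (+ 1 - + 2 * x)) (codegree-class (vertex i) (vertex j) i≢j))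
      (trans (offDiag (codeg c d)) (cong (λ w → + 0 + w * blockᶻ c d) (sym (weight≡1 (vertex j)))))
      where
      c = proj₁ (Vec.lookup vertices i)
      d = proj₁ (Vec.lookup vertices j)
      offDiag : ∀ c → + 0 - (+ 1 - + 2 * c) ≡ + 0 + + 1 * ((+ 1 + + 1) * c + - + 1)
      offDiag = solve-∀

    vertices-↭ : ∀ {m′ n′} → m ≡ 3 ℕ.+ m′ → n ≡ 2 ℕ.+ n′ → toList vertices ↭ sortedVertices m′ n′
    vertices-↭ {m′} {n′} m≡ n≡ = ↭-trans (↭-reflexive (trans (Vecₚ.toList-++ (Vec.map _ p) (Vec.map _ q))
        (cong₂ _++_ (Vecₚ.toList-map _ p) (Vecₚ.toList-map _ q))))
      (↭-trans (++⁺ (map⁺ _ p↭) (map⁺ _ q↭)) (↭-reflexive (trans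
        (cong₂ _++_ (classes left (suc m′) 2) (classes right (suc n′) 1))
        (++-assoc (replicate (suc m′) ((left , false) , + 1)) _ _))))
      where
      p↭ : toList p ↭ replicate (suc m′) false ++ replicate 2 true
      p↭ = subst (λ s → toList p ↭ replicate (suc m′) false ++ replicate s true) ∣p∣≡2
        (↭-trans (toList-↭ p (suc m′) (trans (cong (ℕ._+ suc m′) ∣p∣≡2) (sym m≡))) (++-comm (replicate ∣ p ∣ true) _))
      q↭ : toList q ↭ replicate (suc n′) false ++ replicate 1 true
      q↭ = subst (λ s → toList q ↭ replicate (suc n′) false ++ replicate s true) ∣q∣≡1
        (↭-trans (toList-↭ q (suc n′) (trans (cong (ℕ._+ suc n′) ∣q∣≡1) (sym n≡))) (++-comm (replicate ∣ q ∣ true) _))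
      classes : ∀ P k l → List.map (λ b → (P , b) , + 1) (replicate k false ++ replicate l true) ≡
        replicate k ((P , false) , + 1) ++ replicate l ((P , true) , + 1)
      classes P k l = trans (map-++ _ (replicate k false) (replicate l true))
        (cong₂ _++_ (map-replicate _ k false) (map-replicate _ l true))

    det-char : ∀ {m′ n′} → m ≡ 3 ℕ.+ m′ → n ≡ 2 ℕ.+ n′ → ∀ k → det +-*-rawRing (λ i j → onDiagonal i j k - seidel H i j) ≡
      (k - (+ 2 * + n - + 1)) ^ m′ * ((k - (+ 2 * + m - + 1)) ^ n′ * - horner k (ξ₂ (+ m) (+ n)))
    det-char {m′} {n′} m≡ n≡ k = begin
      det +-*-rawRing (λ i j → onDiagonal i j k - seidel H i j)
        ≡⟨ ∣∣ᵈ-unfold _ ⟨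
      ∣ (λ i j → onDiagonal i j k - seidel H i j) ∣ᵈ
        ≡⟨ det-cong (charMatrix-entry k) ⟩
      ∣ classMatrix (diagonal (+ m) (+ n) k) blockᶻ (Vec.lookup vertices) ∣ᵈ
        ≡⟨ classDet-toList (diagonal (+ m) (+ n) k) blockᶻ vertices ⟨
      classDet (diagonal (+ m) (+ n) k) blockᶻ (toList vertices)
        ≡⟨ classDet-↭ (diagonal (+ m) (+ n) k) blockᶻ (vertices-↭ m≡ n≡) ⟩
      classDet (diagonal (+ m) (+ n) k) blockᶻ (sortedVertices m′ n′)
        ≡⟨ classDet-sorted (+ m) (+ n) k m′ n′ (cong (λ m → + m + - (+ 2)) m≡) (cong (λ n → + n + - (+ 1)) n≡) ⟩
      (k - (+ 2 * + n - + 1)) ^ m′ * ((k - (+ 2 * + m - + 1)) ^ n′ * - horner k (ξ₂ (+ m) (+ n))) ∎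
      where open ≡-Reasoning

-- Evaluation of polynomials and the map from the integers

module PolynomialEvaluation {c ℓ} (K : CommutativeRing c ℓ) where

  open import Algebra.Morphism.Structures using (module RingMorphisms)
  open import Data.Bool using (if_then_else_)
  open import Data.Fin as Fin using (Fin; zero; suc; toℕ; punchIn)
  open import Data.Integer as ℤ using (ℤ; +_; -[1+_]; _⊖_; +-*-rawRing)
  import Data.Integer.Properties as ℤₚ
  open import Data.List using ([]; _∷_; foldr; map)
  open import Data.Nat using (zero; suc)
  import Data.Nat.Properties as ℕₚ
  open import Data.Product using (∃; _,_; proj₁; proj₂)
  open import Relation.Binary.PropositionalEquality as ≡ using (_≡_)
  open import Relation.Nullary using (yes; no; does)

  open CommutativeRing K hiding (zero)
  open import Algebra.Definitions.RawMonoid +-rawMonoid using (sum) renaming (_×_ to _⋆_)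
  open import Algebra.Definitions.RawSemiring (Semiring.rawSemiring semiring) using (_^_)
  open import Algebra.Properties.Ring ring using (-0#≈0#; -‿+-comm; -‿involutive; -‿distribˡ-*; -‿distribʳ-*)
  open import Algebra.Properties.Semiring.Mult semiring using (×1-homo-*; ×-homo-+)
  open import Algebra.Properties.Semiring.Sum semiring using (sum-cong-≋)
  open import Algebra.Solver.Ring.NaturalCoefficients.Default commutativeSemiring
    using (solve; _:=_; _:*_; _:+_)
  open import Relation.Binary.Reasoning.Setoid setoid
  open Polynomial rawRing

  module RingMorphism {a ℓ′} (R : RawRing a ℓ′) where
    private module R = RawRing R
    open RingMorphisms R rawRing public using (IsRingHomomorphism)

    ringHomomorphism : ∀ {f : R.Carrier → Carrier} →
      (∀ {x y} → x R.≈ y → f x ≈ f y) →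
      (∀ x y → f (x R.+ y) ≈ f x + f y) → (∀ x y → f (x R.* y) ≈ f x * f y) →
      (∀ x → f (R.- x) ≈ - f x) → f R.0# ≈ 0# → f R.1# ≈ 1# → IsRingHomomorphism f
    ringHomomorphism f-cong f-+ f-* f-neg f-0 f-1 = record
      { isSemiringHomomorphism = record
        { isNearSemiringHomomorphism = record
          { +-isMonoidHomomorphism = record
            { isMagmaHomomorphism = record
              { isRelHomomorphism = record { cong = f-cong }
              ; homo = f-+ }
            ; ε-homo = f-0 }
          ; *-homo = f-* }
        ; 1#-homo = f-1 }
      ; -‿homo = f-neg }

    module _ {f : R.Carrier → Carrier} (f-hom : IsRingHomomorphism f) where
      open IsRingHomomorphism f-hom

      open import Algebra.Definitions.RawMonoid R.+-rawMonoid using () renaming (sum to sumᴿ)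
      open import Algebra.Definitions.RawSemiring R.rawSemiring using () renaming (_^_ to _^ᴿ_)

      sum-homo : ∀ {n} (g : Fin n → R.Carrier) → f (sumᴿ g) ≈ sum (λ i → f (g i))
      sum-homo {zero}  g = 0#-homo
      sum-homo {suc n} g = trans (+-homo _ _) (+-congˡ (sum-homo λ i → g (suc i)))

      ^-homo : ∀ x k → f (x ^ᴿ k) ≈ f x ^ k
      ^-homo x zero    = 1#-homo
      ^-homo x (suc k) = trans (*-homo _ _) (*-congˡ (^-homo x k))

      -- Serves two maps into `K`: evaluation of polynomials at a point, and `fromℤ`. The source is
      -- a raw ring because coefficient lists come without ring laws.
      det-homo : ∀ {n} (M : Matrix R.Carrier n) (N : Matrix Carrier n) → (∀ i j → f (M i j) ≈ N i j) →
        f (det R M) ≈ det rawRing N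
      det-homo {zero}  M N M≈N = 1#-homo
      det-homo {suc n} M N M≈N = trans (sum-homo λ j → ((R.- R.1#) ^ᴿ toℕ j) R.* (M zero j R.* det R (λ i k → M (suc i) (punchIn j k))))
        (sum-cong-≋ λ j → trans (*-homo _ _) (*-cong
          (trans (^-homo (R.- R.1#) (toℕ j)) (^-cong (toℕ j) (trans (-‿homo R.1#) (-‿cong 1#-homo))))
          (trans (*-homo _ _) (*-cong (M≈N zero j)
            (det-homo (λ i k → M (suc i) (punchIn j k)) (λ i k → N (suc i) (punchIn j k)) λ i k → M≈N (suc i) (punchIn j k))))))
        where
        ^-cong : ∀ {x y} k → x ≈ y → x ^ k ≈ y ^ k
        ^-cong zero    x≈y = refl
        ^-cong (suc k) x≈y = *-cong x≈y (^-cong k x≈y)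

  open RingMorphism +-*-rawRing using () renaming (ringHomomorphism to ℤ-ringHomomorphism; IsRingHomomorphism to IsℤHomomorphism)

  fromℤ-⊖ : ∀ m n → fromℤ K (m ⊖ n) ≈ m ⋆ 1# - n ⋆ 1#
  fromℤ-⊖ zero    zero    = sym (-‿inverseʳ _)
  fromℤ-⊖ zero    (suc n) = sym (+-identityˡ _)
  fromℤ-⊖ (suc m) zero    = sym (trans (+-congˡ -0#≈0#) (+-identityʳ _))
  fromℤ-⊖ (suc m) (suc n) = begin
    fromℤ K (suc m ⊖ suc n)                    ≡⟨ ≡.cong (fromℤ K) (ℤₚ.[1+m]⊖[1+n]≡m⊖n m n) ⟩
    fromℤ K (m ⊖ n)                            ≈⟨ fromℤ-⊖ m n ⟩
    m ⋆ 1# - n ⋆ 1#                            ≈⟨ +-identityˡ _ ⟨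
    0# + (m ⋆ 1# - n ⋆ 1#)                     ≈⟨ +-congʳ (-‿inverseʳ 1#) ⟨
    (1# - 1#) + (m ⋆ 1# - n ⋆ 1#)              ≈⟨ solve 4 (λ x y z w → (x :+ y) :+ (z :+ w) := (x :+ z) :+ (y :+ w)) refl 1# (- 1#) _ _ ⟩
    suc m ⋆ 1# + (- 1# - n ⋆ 1#)               ≈⟨ +-congˡ (-‿+-comm 1# (n ⋆ 1#)) ⟩
    suc m ⋆ 1# - suc n ⋆ 1#                    ∎

  fromℤ-neg : ∀ i → fromℤ K (ℤ.- i) ≈ - fromℤ K i
  fromℤ-neg (+ zero)  = sym -0#≈0#
  fromℤ-neg (+ suc n) = refl
  fromℤ-neg -[1+ n ]  = sym (-‿involutive _)

  fromℤ-+ : ∀ i j → fromℤ K (i ℤ.+ j) ≈ fromℤ K i + fromℤ K j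
  fromℤ-+ (+ m)    (+ n)    = ×-homo-+ 1# m n
  fromℤ-+ (+ m)    -[1+ n ] = fromℤ-⊖ m (suc n)
  fromℤ-+ -[1+ m ] (+ n)    = trans (fromℤ-⊖ n (suc m)) (+-comm _ _)
  fromℤ-+ -[1+ m ] -[1+ n ] = trans
    (-‿cong (trans (reflexive (≡.cong (λ k → suc k ⋆ 1#) (≡.sym (ℕₚ.+-suc m n)))) (×-homo-+ 1# (suc m) (suc n))))
    (sym (-‿+-comm _ _))

  fromℤ-* : ∀ i j → fromℤ K (i ℤ.* j) ≈ fromℤ K i * fromℤ K j
  fromℤ-* i j = helper i
    where
    nonNegative : ∀ m j → fromℤ K (+ m ℤ.* j) ≈ m ⋆ 1# * fromℤ K j
    nonNegative m (+ n)    = trans (reflexive (≡.cong (fromℤ K) (≡.sym (ℤₚ.pos-* m n)))) (×1-homo-* m n)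
    nonNegative m -[1+ n ] = begin
      fromℤ K (+ m ℤ.* ℤ.- (+ suc n))   ≡⟨ ≡.cong (fromℤ K) (ℤₚ.neg-distribʳ-* (+ m) (+ suc n)) ⟨
      fromℤ K (ℤ.- (+ m ℤ.* + suc n))   ≈⟨ trans (fromℤ-neg (+ m ℤ.* + suc n)) (-‿cong (nonNegative m (+ suc n))) ⟩
      - (m ⋆ 1# * suc n ⋆ 1#)           ≈⟨ -‿distribʳ-* _ _ ⟩
      m ⋆ 1# * - (suc n ⋆ 1#)           ∎

    helper : ∀ i → fromℤ K (i ℤ.* j) ≈ fromℤ K i * fromℤ K j
    helper (+ m)    = nonNegative m j
    helper -[1+ m ] = begin
      fromℤ K (ℤ.- (+ suc m) ℤ.* j)     ≡⟨ ≡.cong (fromℤ K) (ℤₚ.neg-distribˡ-* (+ suc m) j) ⟨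
      fromℤ K (ℤ.- (+ suc m ℤ.* j))     ≈⟨ trans (fromℤ-neg (+ suc m ℤ.* j)) (-‿cong (nonNegative (suc m) j)) ⟩
      - (suc m ⋆ 1# * fromℤ K j)        ≈⟨ -‿distribˡ-* _ _ ⟩
      - (suc m ⋆ 1#) * fromℤ K j        ∎

  fromℤ-homomorphism : IsℤHomomorphism (fromℤ K)
  fromℤ-homomorphism = ℤ-ringHomomorphism (λ { ≡.refl → refl }) fromℤ-+ fromℤ-* fromℤ-neg refl (+-identityʳ 1#)

  eval : Poly → Carrier → Carrier
  eval p t = foldr (λ x y → x + t * y) 0# p

  coeff-⊕ : ∀ p q k → coeff (p ⊕ q) k ≈ coeff p k + coeff q k
  coeff-⊕ []      q       k       = sym (+-identityˡ _)
  coeff-⊕ (x ∷ p) []      k       = sym (+-identityʳ _)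
  coeff-⊕ (x ∷ p) (y ∷ q) zero    = refl
  coeff-⊕ (x ∷ p) (y ∷ q) (suc k) = coeff-⊕ p q k

  coeff-scale : ∀ c p k → coeff (map (c *_) p) k ≈ c * coeff p k
  coeff-scale c []      k       = sym (zeroʳ c)
  coeff-scale c (x ∷ p) zero    = refl
  coeff-scale c (x ∷ p) (suc k) = coeff-scale c p k

  coeff-⊖ : ∀ p k → coeff (⊖ p) k ≈ - coeff p k
  coeff-⊖ []      k       = sym -0#≈0#
  coeff-⊖ (x ∷ p) zero    = refl
  coeff-⊖ (x ∷ p) (suc k) = coeff-⊖ p k

  module _ (t : Carrier) where

    eval-zero : ∀ p → p ≋ [] → eval p t ≈ 0#
    eval-zero []      p≋0 = refl
    eval-zero (x ∷ p) p≋0 = trans (+-cong (p≋0 0) (trans (*-congˡ (eval-zero p λ k → p≋0 (suc k))) (zeroʳ t))) (+-identityˡ _)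

    eval-cong : ∀ p q → p ≋ q → eval p t ≈ eval q t
    eval-cong []      q       p≋q = sym (eval-zero q λ k → sym (p≋q k))
    eval-cong (x ∷ p) []      p≋q = eval-zero (x ∷ p) p≋q
    eval-cong (x ∷ p) (y ∷ q) p≋q = +-cong (p≋q 0) (*-congˡ (eval-cong p q λ k → p≋q (suc k)))

    eval-⊕ : ∀ p q → eval (p ⊕ q) t ≈ eval p t + eval q t
    eval-⊕ []      q       = sym (+-identityˡ _)
    eval-⊕ (x ∷ p) []      = sym (+-identityʳ _)
    eval-⊕ (x ∷ p) (y ∷ q) = trans (+-congˡ (*-congˡ (eval-⊕ p q)))
      (solve 5 (λ x y t p q → (x :+ y) :+ t :* (p :+ q) := (x :+ t :* p) :+ (y :+ t :* q)) refl x y t _ _)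

    eval-scale : ∀ c p → eval (map (c *_) p) t ≈ c * eval p t
    eval-scale c []      = sym (zeroʳ c)
    eval-scale c (x ∷ p) = trans (+-congˡ (*-congˡ (eval-scale c p)))
      (solve 4 (λ c x t p → c :* x :+ t :* (c :* p) := c :* (x :+ t :* p)) refl c x t _)

    eval-⊖ : ∀ p → eval (⊖ p) t ≈ - eval p t
    eval-⊖ []      = sym -0#≈0#
    eval-⊖ (x ∷ p) = trans (+-congˡ (trans (*-congˡ (eval-⊖ p)) (sym (-‿distribʳ-* t _)))) (-‿+-comm x _)

    eval-⊗ : ∀ p q → eval (p ⊗ q) t ≈ eval p t * eval q t
    eval-⊗ []      q = sym (zeroˡ _)
    eval-⊗ (x ∷ p) q = begin
      eval (map (x *_) q ⊕ (0# ∷ p ⊗ q)) t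
        ≈⟨ eval-⊕ (map (x *_) q) (0# ∷ p ⊗ q) ⟩
      eval (map (x *_) q) t + (0# + t * eval (p ⊗ q) t)
        ≈⟨ +-cong (eval-scale x q) (trans (+-identityˡ _) (*-congˡ (eval-⊗ p q))) ⟩
      x * eval q t + t * (eval p t * eval q t)
        ≈⟨ solve 4 (λ x t p q → x :* q :+ t :* (p :* q) := (x :+ t :* p) :* q) refl x t _ _ ⟩
      (x + t * eval p t) * eval q t ∎

    eval-const : ∀ c → eval (const c) t ≈ c
    eval-const c = trans (+-congˡ (zeroʳ t)) (+-identityʳ c)

    eval-X : eval X t ≈ t
    eval-X = trans (+-identityˡ _) (trans (*-congˡ (eval-const 1#)) (*-identityʳ t))

    eval-homomorphism : RingMorphism.IsRingHomomorphism polyRawRing (λ p → eval p t)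
    eval-homomorphism = RingMorphism.ringHomomorphism polyRawRing
      (λ {p} {q} → eval-cong p q) eval-⊕ eval-⊗ eval-⊖ refl (eval-const 1#)

  eval-charPoly : ∀ {n} (A : Matrix Carrier n) t →
    eval (charPoly A) t ≈ det rawRing (λ i j → (if does (i Fin.≟ j) then t else 0#) - A i j)
  eval-charPoly {n} A t = trans (reflexive (≡.cong (λ p → eval p t) (proj₂ charMatrix)))
    (RingMorphism.det-homo polyRawRing (eval-homomorphism t) (proj₁ charMatrix) _ entry)
    where
    -- The matrix inside `charPoly` rests on a local definition; unification against `refl` recovers
    -- it.
    charMatrix : ∃ λ (M : Matrix Poly n) → charPoly A ≡ det polyRawRing M
    charMatrix = _ , ≡.refl

    entry : ∀ i j → eval (proj₁ charMatrix i j) t ≈ (if does (i Fin.≟ j) then t else 0#) - A i j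
    entry i j with i Fin.≟ j
    ... | yes _ = trans (eval-⊕ t X (⊖ const (A i j))) (+-cong (eval-X t)
                    (trans (eval-⊖ t (const (A i j))) (-‿cong (eval-const t (A i j)))))
    ... | no _  = trans (eval-⊖ t (const (A i j))) (trans (-‿cong (eval-const t (A i j))) (sym (+-identityˡ _)))

-- Splitting polynomials over a field of characteristic zero

module SplittingPolynomials {c ℓ} (K : CommutativeRing c ℓ) (isField : IsFieldOfCharZero K) where

  open import Data.Empty using (⊥-elim)
  open import Data.List using (List; []; _∷_; foldr; length; map; _++_)
  open import Data.List.Properties using (length-map)
  open import Data.Nat using (zero; suc; _≤_; _<_; z≤n; s≤s)
  import Data.Nat.Properties as ℕₚ
  open import Data.Product using (∃; _×_; _,_; proj₁; proj₂)
  open import Data.Sum using (inj₁; inj₂)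
  open import Function using (_⇔_; mk⇔)
  open import Relation.Binary.Definitions using (Tri; tri<; tri≈; tri>)
  open import Relation.Binary.PropositionalEquality as ≡ using (_≡_)
  open import Relation.Nullary using (¬_)

  open CommutativeRing K hiding (zero)
  open IsFieldOfCharZero isField
  open import Algebra.Definitions.RawMonoid +-rawMonoid using () renaming (_×_ to _⋆_)
  open import Algebra.Properties.Ring ring
  open import Algebra.Solver.Ring.NaturalCoefficients.Default commutativeSemiring
    using (solve; _:=_; _:*_; _:+_)
  open import Data.List.Relation.Binary.Permutation.Setoid setoid
    using (_↭_; ↭-refl; ↭-trans; ↭-prep; ↭-swap; prep)
  open import Data.List.Relation.Binary.Permutation.Setoid.Properties setoid using (foldr-commMonoid; map⁺)
  open import Relation.Binary.Reasoning.Setoid setoid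
  open Polynomial rawRing
  open PolynomialEvaluation K

  1≉0 : ¬ 1# ≈ 0#
  1≉0 1≈0 = charZero 0 (trans (+-identityʳ 1#) 1≈0)

  x*y≈0⇒y≈0 : ∀ {x y} → ¬ x ≈ 0# → x * y ≈ 0# → y ≈ 0#
  x*y≈0⇒y≈0 {x} {y} x≉0 xy≈0 with zero⊎invertible x
  ... | inj₁ x≈0 = ⊥-elim (x≉0 x≈0)
  ... | inj₂ (x⁻¹ , xx⁻¹≈1) = begin
    y              ≈⟨ *-identityˡ y ⟨
    1# * y         ≈⟨ *-congʳ xx⁻¹≈1 ⟨
    x * x⁻¹ * y    ≈⟨ solve 3 (λ x z y → x :* z :* y := z :* (x :* y)) refl x x⁻¹ y ⟩
    x⁻¹ * (x * y)  ≈⟨ trans (*-congˡ xy≈0) (zeroʳ x⁻¹) ⟩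
    0#             ∎

  *-cancelˡ-≉0 : ∀ {x y z} → ¬ x ≈ 0# → x * y ≈ x * z → y ≈ z
  *-cancelˡ-≉0 {x} {y} {z} x≉0 xy≈xz = x∙y⁻¹≈ε⇒x≈y y z (x*y≈0⇒y≈0 x≉0 (begin
    x * (y - z)        ≈⟨ x[y-z]≈xy-xz x y z ⟩
    x * y - x * z      ≈⟨ trans (+-congʳ xy≈xz) (-‿inverseʳ _) ⟩
    0#                 ∎))

  eval-congʳ : ∀ p {t u} → t ≈ u → eval p t ≈ eval p u
  eval-congʳ []      t≈u = refl
  eval-congʳ (x ∷ p) t≈u = +-congˡ (*-cong t≈u (eval-congʳ p t≈u))

  -- Synthetic division by X − s, without the remainder.
  quot : Poly → Carrier → Poly
  quot []      s = []
  quot (x ∷ p) s = p ⊕ map (s *_) (quot p s)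

  -- Write t p(t) as s p(t) + (t - s) p(t) and divide the first summand by induction.
  eval-quot : ∀ p s t → eval p t ≈ eval p s + (t - s) * eval (quot p s) t
  eval-quot []      s t = sym (trans (+-identityˡ _) (zeroʳ _))
  eval-quot (x ∷ p) s t = sym (begin
    (x + s * eval p s) + (t - s) * eval (p ⊕ map (s *_) (quot p s)) t
      ≈⟨ +-congˡ (*-congˡ (trans (eval-⊕ t p (map (s *_) (quot p s))) (+-congˡ (eval-scale t s (quot p s))))) ⟩
    (x + s * eval p s) + (t - s) * (eval p t + s * eval (quot p s) t)
      ≈⟨ solve 6 (λ x s d a b q → (x :+ s :* a) :+ d :* (b :+ s :* q) := x :+ (s :* (a :+ d :* q) :+ d :* b))
           refl x s (t - s) (eval p s) (eval p t) (eval (quot p s) t) ⟩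
    x + (s * (eval p s + (t - s) * eval (quot p s) t) + (t - s) * eval p t)
      ≈⟨ +-congˡ (+-congʳ (*-congˡ (eval-quot p s t))) ⟨
    x + (s * eval p t + (t - s) * eval p t)
      ≈⟨ +-congˡ (distribʳ _ s (t - s)) ⟨
    x + (s + (t - s)) * eval p t
      ≈⟨ +-congˡ (*-congʳ (trans (+-comm s _) (trans (+-assoc t (- s) s) (trans (+-congˡ (-‿inverseˡ s)) (+-identityʳ t))))) ⟩
    x + t * eval p t ∎)

  length-⊕ : ∀ p q {n} → length p ≤ n → length q ≤ n → length (p ⊕ q) ≤ n
  length-⊕ []      q       _         q≤        = q≤
  length-⊕ (x ∷ p) []      p≤        _         = p≤
  length-⊕ (x ∷ p) (y ∷ q) (s≤s p≤) (s≤s q≤) = s≤s (length-⊕ p q p≤ q≤)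

  length-quot : ∀ x p s → length (quot (x ∷ p) s) ≤ length p
  length-quot x []      s = z≤n
  length-quot x (y ∷ p) s = length-⊕ (y ∷ p) (map (s *_) (quot (y ∷ p) s)) ℕₚ.≤-refl
    (ℕₚ.≤-trans (ℕₚ.≤-reflexive (length-map (s *_) (quot (y ∷ p) s))) (ℕₚ.≤-trans (length-quot y p s) (ℕₚ.n≤1+n _)))

  -- In characteristic zero the progression b, b + 1, b + 2, … has no repetitions.
  vanishing : ∀ n p → length p ≤ n → ∀ b → (∀ k → eval p (b + k ⋆ 1#) ≈ 0#) → p ≋ []
  vanishing n       []      _        b p≈0 k = refl
  vanishing (suc n) (x ∷ p) (s≤s p≤) b p≈0 = λ { zero → x≈0 ; (suc k) → p≋0 k }
    where
    s = b + 0 ⋆ 1#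

    s+k : ∀ b k → (b + 1#) + k ⋆ 1# ≈ b + suc k ⋆ 1#
    s+k b k = +-assoc b 1# _

    difference : ∀ k → ((b + 1#) + k ⋆ 1#) - s ≈ suc k ⋆ 1#
    difference k = begin
      ((b + 1#) + k ⋆ 1#) - (b + 0#)   ≈⟨ +-cong (s+k b k) (-‿cong (+-identityʳ b)) ⟩
      (b + suc k ⋆ 1#) - b             ≈⟨ solve 3 (λ b k b′ → (b :+ k) :+ b′ := (b :+ b′) :+ k) refl b _ (- b) ⟩
      (b - b) + suc k ⋆ 1#             ≈⟨ trans (+-congʳ (-‿inverseʳ b)) (+-identityˡ _) ⟩
      suc k ⋆ 1#                       ∎

    quot≋0 : quot (x ∷ p) s ≋ []
    -- From `b + 1#` on, `t - s` is a positive integer in `K` and cancels; the quotient is shorter,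
    -- so induction applies.
    quot≋0 = vanishing n (quot (x ∷ p) s) (ℕₚ.≤-trans (length-quot x p s) p≤) (b + 1#) λ k →
      let t = (b + 1#) + k ⋆ 1# in
      x*y≈0⇒y≈0 (λ d≈0 → charZero k (trans (sym (difference k)) d≈0)) (begin
        (t - s) * eval (quot (x ∷ p) s) t                       ≈⟨ +-identityˡ _ ⟨
        0# + (t - s) * eval (quot (x ∷ p) s) t                  ≈⟨ +-congʳ (p≈0 0) ⟨
        eval (x ∷ p) s + (t - s) * eval (quot (x ∷ p) s) t      ≈⟨ eval-quot (x ∷ p) s t ⟨
        eval (x ∷ p) t                                          ≈⟨ eval-congʳ (x ∷ p) (s+k b k) ⟩
        eval (x ∷ p) (b + suc k ⋆ 1#)                           ≈⟨ p≈0 (suc k) ⟩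
        0#                                                      ∎)

    everywhere : ∀ t → eval (x ∷ p) t ≈ 0#
    everywhere t = begin
      eval (x ∷ p) t                                        ≈⟨ eval-quot (x ∷ p) s t ⟩
      eval (x ∷ p) s + (t - s) * eval (quot (x ∷ p) s) t    ≈⟨ +-cong (p≈0 0) (trans (*-congˡ (eval-zero t (quot (x ∷ p) s) quot≋0)) (zeroʳ _)) ⟩
      0# + 0#                                               ≈⟨ +-identityˡ _ ⟩
      0#                                                    ∎

    x≈0 : x ≈ 0#
    x≈0 = trans (sym (trans (+-congˡ (zeroˡ _)) (+-identityʳ x))) (everywhere 0#)

    p≋0 : p ≋ []
    -- Since `x` is zero, t p(t) vanishes everywhere. The progression starts at `1#` because `t`
    -- must be non-zero to be cancelled.
    p≋0 = vanishing n p p≤ 1# λ k → x*y≈0⇒y≈0 (charZero k)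
      (trans (sym (+-identityˡ _)) (trans (+-congʳ (sym x≈0)) (everywhere (suc k ⋆ 1#))))

  -- The starting point `b` is free, so that a zero of a factor to be cancelled can be avoided.
  agree⇒≋ : ∀ p q b → (∀ k → eval p (b + k ⋆ 1#) ≈ eval q (b + k ⋆ 1#)) → p ≋ q
  agree⇒≋ p q b agree k = x∙y⁻¹≈ε⇒x≈y _ _ (begin
    coeff p k - coeff q k      ≈⟨ +-congˡ (coeff-⊖ q k) ⟨
    coeff p k + coeff (⊖ q) k  ≈⟨ coeff-⊕ p (⊖ q) k ⟨
    coeff (p ⊕ (⊖ q)) k        ≈⟨ vanishing _ (p ⊕ (⊖ q)) ℕₚ.≤-refl b difference k ⟩
    0#                         ∎)
    where
    difference : ∀ k → eval (p ⊕ (⊖ q)) (b + k ⋆ 1#) ≈ 0#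
    difference k = trans (eval-⊕ _ p (⊖ q)) (trans (+-cong (agree k) (eval-⊖ _ q)) (-‿inverseʳ _))

  linear : Carrier → Poly
  linear r = X ⊕ (⊖ const r)

  factors : List Carrier → Poly → Poly
  factors rs q = foldr (λ r → linear r ⊗_) q rs

  factorsAt : Carrier → List Carrier → Carrier → Carrier
  factorsAt t rs y = foldr (λ r → (t - r) *_) y rs

  eval-linear : ∀ r t → eval (linear r) t ≈ t - r
  eval-linear r t = trans (eval-⊕ t X (⊖ const r))
    (+-cong (eval-X t) (trans (eval-⊖ t (const r)) (-‿cong (eval-const t r))))

  eval-factors : ∀ rs q t → eval (factors rs q) t ≈ factorsAt t rs (eval q t)
  eval-factors []       q t = refl
  eval-factors (r ∷ rs) q t = trans (eval-⊗ t (linear r) (factors rs q))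
    (*-cong (eval-linear r t) (eval-factors rs q t))

  ∏ : Carrier → List Carrier → Carrier
  ∏ t rs = factorsAt t rs 1#

  factorsAt-++ : ∀ t rs ss y → factorsAt t (rs ++ ss) y ≡ factorsAt t rs (factorsAt t ss y)
  factorsAt-++ t []       ss y = ≡.refl
  factorsAt-++ t (r ∷ rs) ss y = ≡.cong ((t - r) *_) (factorsAt-++ t rs ss y)

  factorsAt-* : ∀ t rs c y → factorsAt t rs (c * y) ≈ c * factorsAt t rs y
  factorsAt-* t []       c y = refl
  factorsAt-* t (r ∷ rs) c y = trans (*-congˡ (factorsAt-* t rs c y))
    (solve 3 (λ d c x → d :* (c :* x) := c :* (d :* x)) refl (t - r) c _)

  factorsAt-cong : ∀ t rs {y z} → y ≈ z → factorsAt t rs y ≈ factorsAt t rs z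
  factorsAt-cong t []       y≈z = y≈z
  factorsAt-cong t (r ∷ rs) y≈z = *-congˡ (factorsAt-cong t rs y≈z)

  ∏-↭ : ∀ t {rs ss} → rs ↭ ss → ∏ t rs ≈ ∏ t ss
  ∏-↭ t {rs} {ss} rs↭ss = trans (reflexive (≡.sym (foldr-map rs))) (trans
    (foldr-commMonoid *-isCommutativeMonoid
      (map⁺ setoid {f = λ r → t - r} (λ r≈s → +-congˡ (-‿cong r≈s)) rs↭ss))
    (reflexive (foldr-map ss)))
    where
    foldr-map : ∀ rs → foldr _*_ 1# (map (λ r → t - r) rs) ≡ ∏ t rs
    foldr-map []       = ≡.refl
    foldr-map (r ∷ rs) = ≡.cong ((t - r) *_) (foldr-map rs)

  splitPoly : Carrier → List Carrier → Poly
  splitPoly c rs = const c ⊗ factors rs (const 1#)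

  -- Since K is infinite, splitting can be tested on values.
  Splits : Poly → List Carrier → Set _
  Splits p rs = ∃ λ c → (¬ c ≈ 0#) × (∀ t → eval p t ≈ c * ∏ t rs)

  eval-split : ∀ c rs t → eval (splitPoly c rs) t ≈ c * ∏ t rs
  eval-split c rs t = trans (eval-⊗ t (const c) (factors rs (const 1#)))
    (*-cong (eval-const t c) (trans (eval-factors rs (const 1#) t) (factorsAt-cong t rs (eval-const t 1#))))

  roots⇔splits : ∀ p rs → RootsWithMultiplicity p rs ⇔ Splits p rs
  roots⇔splits p rs = mk⇔
    (λ { (c , c≉0 , p≋) → c , c≉0 , λ t → trans (eval-cong t p (splitPoly c rs) p≋) (eval-split c rs t) })
    (λ { (c , c≉0 , p≈) → c , c≉0 , agree⇒≋ p (splitPoly c rs) 0# λ k → trans (p≈ (0# + k ⋆ 1#)) (sym (eval-split c rs (0# + k ⋆ 1#))) })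

  -- `zero⊎invertible` decides whether the head equals `a`; otherwise its factor cancels and the
  -- search continues in the tail.
  ∏≈0⇒root : ∀ a rs → ∏ a rs ≈ 0# → ∃ λ rs′ → rs ↭ a ∷ rs′
  ∏≈0⇒root a []       1≈0 = ⊥-elim (1≉0 1≈0)
  ∏≈0⇒root a (r ∷ rs) ∏≈0 with zero⊎invertible (a - r)
  ... | inj₁ a-r≈0 = rs , prep (sym (x∙y⁻¹≈ε⇒x≈y a r a-r≈0)) ↭-refl
  ... | inj₂ (x , inverse) =
    let rs′ , rs↭ = ∏≈0⇒root a rs (x*y≈0⇒y≈0 (λ a-r≈0 → 1≉0 (trans (sym inverse) (trans (*-congʳ a-r≈0) (zeroˡ x)))) ∏≈0)
    in r ∷ rs′ , ↭-trans (↭-prep r rs↭) (↭-swap r a ↭-refl)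

  -- As p(a) = 0, the root `a` occurs in `rs`. At a + 1, a + 2, ... the factor t - a cancels, and
  -- agreement there already determines `q`.
  splits-linear : ∀ p q a rs → (∀ t → eval p t ≈ (t - a) * eval q t) → Splits p rs →
    ∃ λ rs′ → rs ↭ a ∷ rs′ × Splits q rs′
  splits-linear p q a rs p≈ (c , c≉0 , p-splits) = rs′ , rs↭ , c , c≉0 , λ t →
    trans (eval-cong t q (splitPoly c rs′) q≋) (eval-split c rs′ t)
    where
    root : ∃ λ rs′ → rs ↭ a ∷ rs′
    root = ∏≈0⇒root a rs (x*y≈0⇒y≈0 c≉0 (begin
      c * ∏ a rs           ≈⟨ p-splits a ⟨
      eval p a             ≈⟨ p≈ a ⟩
      (a - a) * eval q a   ≈⟨ trans (*-congʳ (-‿inverseʳ a)) (zeroˡ _) ⟩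
      0#                   ∎))
    rs′ = proj₁ root
    rs↭ = proj₂ root

    q≋ : q ≋ splitPoly c rs′
    q≋ = agree⇒≋ q (splitPoly c rs′) (a + 1#) λ k →
      let t = (a + 1#) + k ⋆ 1# in
      trans (*-cancelˡ-≉0 (λ t-a≈0 → charZero k (trans (sym (difference k)) t-a≈0)) (begin
        (t - a) * eval q t          ≈⟨ p≈ t ⟨
        eval p t                    ≈⟨ p-splits t ⟩
        c * ∏ t rs                  ≈⟨ *-congˡ (∏-↭ t rs↭) ⟩
        c * ((t - a) * ∏ t rs′)     ≈⟨ solve 3 (λ c d x → c :* (d :* x) := d :* (c :* x)) refl c (t - a) (∏ t rs′) ⟩
        (t - a) * (c * ∏ t rs′)     ∎))
      (sym (eval-split c rs′ t))
      where
      difference : ∀ k → ((a + 1#) + k ⋆ 1#) - a ≈ suc k ⋆ 1#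
      difference k = trans
        (solve 4 (λ a o k a′ → ((a :+ o) :+ k) :+ a′ := (a :+ a′) :+ (o :+ k)) refl a 1# _ (- a))
        (trans (+-congʳ (-‿inverseʳ a)) (+-identityˡ _))

  -- Takes the place of unique factorisation: each known factor is cancelled against an entry of
  -- `rs`, and the entries left over split `q`. Conversely the factors are multiplied back.
  splits-factors : ∀ p q as rs → (∀ t → eval p t ≈ eval (factors as q) t) →
    Splits p rs ⇔ (∃ λ τ → rs ↭ as ++ τ × Splits q τ)
  splits-factors p q as rs p≈ = mk⇔ (split as p rs p≈) join
    where
    split : ∀ as p rs → (∀ t → eval p t ≈ eval (factors as q) t) → Splits p rs →
      ∃ λ τ → rs ↭ as ++ τ × Splits q τ
    split []       p rs p≈ (c , c≉0 , p-splits) = rs , ↭-refl , c , c≉0 , λ t → trans (sym (p≈ t)) (p-splits t)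
    split (a ∷ as) p rs p≈ p-splits =
      let rs′ , rs↭ , rest-splits = splits-linear p (factors as q) a rs
            (λ t → trans (p≈ t) (trans (eval-⊗ t (linear a) (factors as q)) (*-congʳ (eval-linear a t)))) p-splits
          τ , rs′↭ , q-splits = split as (factors as q) rs′ (λ t → refl) rest-splits
      in τ , ↭-trans rs↭ (↭-prep a rs′↭) , q-splits

    join : (∃ λ τ → rs ↭ as ++ τ × Splits q τ) → Splits p rs
    join (τ , rs↭ , c , c≉0 , q-splits) = c , c≉0 , λ t → begin
      eval p t                       ≈⟨ trans (p≈ t) (eval-factors as q t) ⟩
      factorsAt t as (eval q t)      ≈⟨ factorsAt-cong t as (q-splits t) ⟩
      factorsAt t as (c * ∏ t τ)     ≈⟨ factorsAt-* t as c (∏ t τ) ⟩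
      c * factorsAt t as (∏ t τ)     ≡⟨ ≡.cong (c *_) (factorsAt-++ t as τ 1#) ⟨
      c * ∏ t (as ++ τ)              ≈⟨ *-congˡ (∏-↭ t rs↭) ⟨
      c * ∏ t rs                     ∎

  splits-⊖ : ∀ p q rs → (∀ t → eval p t ≈ - eval q t) → Splits q rs → Splits p rs
  splits-⊖ p q rs p≈ (c , c≉0 , q-splits) = - c , (λ -c≈0 → c≉0 (trans (sym (-‿involutive c)) (trans (-‿cong -c≈0) -0#≈0#))) ,
    λ t → trans (p≈ t) (trans (-‿cong (q-splits t)) (-‿distribˡ-* c _))

  coeff-0∷[] : ∀ k → coeff (0# ∷ []) k ≈ 0#
  coeff-0∷[] zero    = refl
  coeff-0∷[] (suc k) = refl

  -- `linear r` computes to `(0# - r) ∷ 1# ∷ []`.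
  coeff-linear-⊗ : ∀ r q k → coeff (linear r ⊗ q) (suc k) ≈ (0# - r) * coeff q (suc k) + coeff q k
  coeff-linear-⊗ r q k = trans (coeff-⊕ (map ((0# - r) *_) q) _ (suc k)) (+-cong (coeff-scale (0# - r) q (suc k))
    (trans (coeff-⊕ (map (1# *_) q) (0# ∷ []) k) (trans (+-cong (trans (coeff-scale 1# q k) (*-identityˡ _)) (coeff-0∷[] k)) (+-identityʳ _))))

  coeff-factors-> : ∀ rs {k} → length rs < k → coeff (factors rs (const 1#)) k ≈ 0#
  coeff-factors-> []       {suc k} _           = refl
  coeff-factors-> (r ∷ rs) {suc k} (s≤s rs<k) = begin
    coeff (linear r ⊗ factors rs (const 1#)) (suc k)
      ≈⟨ coeff-linear-⊗ r (factors rs (const 1#)) k ⟩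
    (0# - r) * coeff (factors rs (const 1#)) (suc k) + coeff (factors rs (const 1#)) k
      ≈⟨ +-cong (trans (*-congˡ (coeff-factors-> rs (ℕₚ.m<n⇒m<1+n rs<k))) (zeroʳ _)) (coeff-factors-> rs rs<k) ⟩
    0# + 0#
      ≈⟨ +-identityˡ _ ⟩
    0# ∎

  coeff-factors-leading : ∀ rs → coeff (factors rs (const 1#)) (length rs) ≈ 1#
  coeff-factors-leading []       = refl
  coeff-factors-leading (r ∷ rs) = begin
    coeff (linear r ⊗ factors rs (const 1#)) (suc (length rs))
      ≈⟨ coeff-linear-⊗ r (factors rs (const 1#)) (length rs) ⟩
    (0# - r) * coeff (factors rs (const 1#)) (suc (length rs)) + coeff (factors rs (const 1#)) (length rs)
      ≈⟨ +-cong (trans (*-congˡ (coeff-factors-> rs ℕₚ.≤-refl)) (zeroʳ _)) (coeff-factors-leading rs) ⟩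
    0# + 1#
      ≈⟨ +-identityˡ _ ⟩
    1# ∎

  -- Trailing zeros make the length of a coefficient list useless as a degree. The last non-zero
  -- coefficient, at `d`, is compared with that of the split form, which is `c` at `length rs`.
  roots-length : ∀ p rs d → ¬ coeff p d ≈ 0# → (∀ {k} → d < k → coeff p k ≈ 0#) →
    RootsWithMultiplicity p rs → length rs ≡ d
  roots-length p rs d leading above (c , c≉0 , p≋) = compare (ℕₚ.<-cmp (length rs) d)
    where
    coeff-p : ∀ k → coeff p k ≈ c * coeff (factors rs (const 1#)) k
    coeff-p k = trans (p≋ k) (trans (coeff-⊕ (map (c *_) (factors rs (const 1#))) (0# ∷ []) k) (trans
      (+-cong (coeff-scale c (factors rs (const 1#)) k) (coeff-0∷[] k)) (+-identityʳ _)))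

    compare : Tri (length rs < d) (length rs ≡ d) (d < length rs) → length rs ≡ d
    compare (tri≈ _ eq _)   = eq
    compare (tri< rs<d _ _) = ⊥-elim (leading (trans (coeff-p d) (trans (*-congˡ (coeff-factors-> rs rs<d)) (zeroʳ c))))
    compare (tri> _ _ d<rs) = ⊥-elim (c≉0 (begin
      c                                                    ≈⟨ *-identityʳ c ⟨
      c * 1#                                               ≈⟨ *-congˡ (coeff-factors-leading rs) ⟨
      c * coeff (factors rs (const 1#)) (length rs)        ≈⟨ coeff-p (length rs) ⟨
      coeff p (length rs)                                  ≈⟨ above d<rs ⟩
      0#                                                   ∎))

open import Data.Fin.Subset using (Subset; ∣_∣; _∩_)
open import Data.Integer using (+_; _-_; _*_)
open import Data.List using (List; replicate; _++_)
open import Data.List.Relation.Binary.Permutation.Setoid using (_↭_)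
open import Data.Nat using (ℕ; _≤_; _∸_; _+_)
open import Data.Product using (_×_; ∃)
open import Data.Vec using (Vec; toList)
open import Function.Bundles using (_⇔_)
open import Relation.Binary.PropositionalEquality using (_≡_)

open import Data.Bool as Bool using (if_then_else_)
open import Data.Fin as Fin using ()
import Data.Integer as ℤ
import Data.Integer.Properties as ℤₚ
open import Data.List using (_∷_; []; length; map)
open import Data.List.Properties using (++-assoc)
import Data.Nat as ℕ
open import Data.Nat using (s≤s)
import Data.Nat.Properties as ℕₚ
open import Data.Product using (_,_)
open import Data.Vec as Vec using ()
open import Data.Vec.Properties using (toList∘fromList)
open import Function using (mk⇔; Equivalence; _∘_)
open import Relation.Binary.PropositionalEquality as ≡ using (refl)
open import Relation.Nullary using (does)

open Codegrees using (∣∩V₁∣; ∣∩V₂∣)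
open QuotientDeterminant using (horner)
open SeidelDeterminant using (det-char)
open VertexClasses using (module RawClassMatrix)

-- The Seidel spectrum

module SeidelSpectrum {c ℓ} (K : CommutativeRing c ℓ) (isField : IsFieldOfCharZero K) where
  private module K = CommutativeRing K
  open K using (Carrier; _≈_; 0#; 1#)
  open Polynomial K.rawRing
  open PolynomialEvaluation K
  open SplittingPolynomials K isField
  open import Relation.Binary.Reasoning.Setoid K.setoid
  open import Algebra.Properties.Ring K.ring using (-0#≈0#; -‿involutive)

  fromℤ-sub : ∀ i j → fromℤ K (i - j) ≈ fromℤ K i K.- fromℤ K j
  fromℤ-sub i j = K.trans (fromℤ-+ i (ℤ.- j)) (K.+-congˡ (fromℤ-neg j))

  fromℤ-horner : ∀ xs k → fromℤ K (horner k xs) ≈ eval (map (fromℤ K) xs) (fromℤ K k)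
  fromℤ-horner []       k = K.refl
  fromℤ-horner (x ∷ xs) k = K.trans (fromℤ-+ x (k * horner k xs)) (K.+-congˡ
    (K.trans (fromℤ-* k (horner k xs)) (K.*-congˡ (fromℤ-horner xs k))))

  fromℤ-factors : ∀ k a l x → fromℤ K ((k - a) ℤ.^ l * x) ≈ factorsAt (fromℤ K k) (replicate l (fromℤ K a)) (fromℤ K x)
  fromℤ-factors k a ℕ.zero    x = K.reflexive (≡.cong (fromℤ K) (ℤₚ.*-identityˡ x))
  fromℤ-factors k a (ℕ.suc l) x = K.trans
    (K.reflexive (≡.cong (fromℤ K) (ℤₚ.*-assoc (k - a) ((k - a) ℤ.^ l) x)))
    (K.trans (fromℤ-* (k - a) ((k - a) ℤ.^ l * x)) (K.*-cong (fromℤ-sub k a) (fromℤ-factors k a l x)))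

  seidelCharPoly : ∀ {N} → Hypergraph N → Poly
  seidelCharPoly H = charPoly λ i j → fromℤ K (seidel H i j)

  -- The leading coefficient -1 stays non-zero in `K`, since otherwise 1 would be zero there; so the
  -- degree remains five.
  quintic-roots : ∀ ξ → coeff (map (fromℤ K) ξ) 5 ≈ fromℤ K ℤ.-1ℤ →
    (∀ {k} → 5 ℕ.< k → coeff (map (fromℤ K) ξ) k ≈ 0#) → ∀ τ → IsRootsOf K ξ τ → length τ ≡ 5
  quintic-roots ξ leading above τ = roots-length (map (fromℤ K) ξ) τ 5
    (λ ≈0 → 1≉0 (begin
      1#               ≈⟨ -‿involutive 1# ⟨
      K.- (K.- 1#)     ≈⟨ K.-‿cong (K.-‿cong (K.+-identityʳ 1#)) ⟨
      K.- fromℤ K ℤ.-1ℤ ≈⟨ K.-‿cong (K.trans (K.sym leading) ≈0) ⟩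
      K.- 0#           ≈⟨ -0#≈0# ⟩
      0#               ∎))
    above

  module _ {N : ℕ} (H : Hypergraph N) (a b : ℤ.ℤ) (k l : ℕ) (ξ : List ℤ.ℤ)
    (five-roots : ∀ τ → IsRootsOf K ξ τ → length τ ≡ 5)
    (det-seidel : ∀ t → det ℤ.+-*-rawRing (λ i j → RawClassMatrix.onDiagonal ℤ.+-*-rawRing i j t - seidel H i j) ≡
      (t - a) ℤ.^ k * ((t - b) ℤ.^ l * ℤ.- horner t ξ)) where

    private
      Ξ : Poly
      Ξ = map (fromℤ K) ξ

    knownRoots : List Carrier
    knownRoots = replicate k (fromℤ K a) ++ replicate l (fromℤ K b)

    eval-seidelCharPoly-ℤ : ∀ z → eval (seidelCharPoly H) (fromℤ K z) ≈ eval (factors knownRoots (⊖ Ξ)) (fromℤ K z)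
    eval-seidelCharPoly-ℤ z = begin
      eval (seidelCharPoly H) t
        ≈⟨ eval-charPoly (λ i j → fromℤ K (seidel H i j)) t ⟩
      det K.rawRing (λ i j → (if does (i Fin.≟ j) then t else 0#) K.- fromℤ K (seidel H i j))
        ≈⟨ RingMorphism.det-homo ℤ.+-*-rawRing fromℤ-homomorphism charMatrixᶻ _ entry ⟨
      fromℤ K (det ℤ.+-*-rawRing charMatrixᶻ)
        ≡⟨ ≡.cong (fromℤ K) (det-seidel z) ⟩
      fromℤ K ((z - a) ℤ.^ k * ((z - b) ℤ.^ l * ℤ.- horner z ξ))
        ≈⟨ K.trans (fromℤ-factors z a k _) (factorsAt-cong t (replicate k (fromℤ K a)) (fromℤ-factors z b l _)) ⟩
      factorsAt t (replicate k (fromℤ K a)) (factorsAt t (replicate l (fromℤ K b)) (fromℤ K (ℤ.- horner z ξ)))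
        ≡⟨ factorsAt-++ t (replicate k (fromℤ K a)) (replicate l (fromℤ K b)) (fromℤ K (ℤ.- horner z ξ)) ⟨
      factorsAt t knownRoots (fromℤ K (ℤ.- horner z ξ))
        ≈⟨ factorsAt-cong t knownRoots (K.trans (fromℤ-neg (horner z ξ))
             (K.trans (K.-‿cong (fromℤ-horner ξ z)) (K.sym (eval-⊖ t Ξ)))) ⟩
      factorsAt t knownRoots (eval (⊖ Ξ) t)
        ≈⟨ eval-factors knownRoots (⊖ Ξ) t ⟨
      eval (factors knownRoots (⊖ Ξ)) t ∎
      where
      t = fromℤ K z
      charMatrixᶻ : Matrix ℤ.ℤ N
      charMatrixᶻ i j = RawClassMatrix.onDiagonal ℤ.+-*-rawRing i j z - seidel H i j

      entry : ∀ i j → fromℤ K (charMatrixᶻ i j) ≈ (if does (i Fin.≟ j) then t else 0#) K.- fromℤ K (seidel H i j)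
      entry i j = K.trans (fromℤ-sub (RawClassMatrix.onDiagonal ℤ.+-*-rawRing i j z) (seidel H i j))
        (K.+-congʳ (K.reflexive (if-fromℤ (does (i Fin.≟ j)))))
        where
        if-fromℤ : ∀ x → fromℤ K (if x then z else + 0) ≡ (if x then t else 0#)
        if-fromℤ Bool.true  = refl
        if-fromℤ Bool.false = refl

    eval-seidelCharPoly : ∀ t → eval (seidelCharPoly H) t ≈ eval (factors knownRoots (⊖ Ξ)) t
    eval-seidelCharPoly t = eval-cong t (seidelCharPoly H) (factors knownRoots (⊖ Ξ))
      (agree⇒≋ (seidelCharPoly H) (factors knownRoots (⊖ Ξ)) 0# λ k → K.trans
        (eval-congʳ (seidelCharPoly H) (K.+-identityˡ _)) (K.trans (eval-seidelCharPoly-ℤ (+ k))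
        (K.sym (eval-congʳ (factors knownRoots (⊖ Ξ)) (K.+-identityˡ _)))))

    -- The sign is absorbed by the constant in front of the linear factors.
    roots-⊖ : ∀ τ → RootsWithMultiplicity Ξ τ ⇔ Splits (⊖ Ξ) τ
    roots-⊖ τ = mk⇔
      (splits-⊖ (⊖ Ξ) Ξ τ (λ t → eval-⊖ t Ξ) ∘ Equivalence.to (roots⇔splits Ξ τ))
      (Equivalence.from (roots⇔splits Ξ τ) ∘ splits-⊖ Ξ (⊖ Ξ) τ
        (λ t → K.trans (K.sym (-‿involutive _)) (K.-‿cong (K.sym (eval-⊖ t Ξ)))))

    spectrum-split : ∀ spectrum → IsSeidelSpectrum K H spectrum ⇔
      (∃ λ (τ : Vec Carrier 5) → IsRootsOf K ξ (toList τ) ×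
        _↭_ K.setoid spectrum
          (replicate k (fromℤ K a) ++
           replicate l (fromℤ K b) ++ toList τ))
    spectrum-split spectrum = mk⇔ to from
      where
      splits : Splits (seidelCharPoly H) spectrum ⇔ (∃ λ τ → _↭_ K.setoid spectrum (knownRoots ++ τ) × Splits (⊖ Ξ) τ)
      splits = splits-factors (seidelCharPoly H) (⊖ Ξ) knownRoots spectrum eval-seidelCharPoly

      reassociate : ∀ τ → knownRoots ++ τ ≡ replicate k (fromℤ K a) ++
        replicate l (fromℤ K b) ++ τ
      reassociate τ = ++-assoc (replicate k (fromℤ K a)) (replicate l (fromℤ K b)) τ

      vector : ∀ (τ : List Carrier) {l} → length τ ≡ l → ∃ λ (v : Vec Carrier l) → toList v ≡ τ
      vector τ refl = Vec.fromList τ , toList∘fromList τ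

      to : _
      to spectral with Equivalence.to splits (Equivalence.to (roots⇔splits (seidelCharPoly H) spectrum) spectral)
      ... | τ , spectrum↭ , τ-splits with Equivalence.from (roots-⊖ τ) τ-splits
      -- The degree of `ξ` fixes the number of remaining roots, which turns the list into a vector.
      ... | τ-roots with vector τ (five-roots τ τ-roots)
      ... | v , refl = v , τ-roots , ≡.subst (_↭_ K.setoid spectrum) (reassociate τ) spectrum↭

      from : _
      from (v , v-roots , spectrum↭) = Equivalence.from (roots⇔splits (seidelCharPoly H) spectrum)
        (Equivalence.from splits (toList v , ≡.subst (_↭_ K.setoid spectrum) (≡.sym (reassociate (toList v))) spectrum↭ ,
          Equivalence.to (roots-⊖ (toList v)) v-roots))

det-seidel : ∀ {m n m′ n′} {e : Subset (m + n)} → (∃ λ (p : Subset m) → ∃ λ (q : Subset n) → e ≡ p Vec.++ q) →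
  ∣ e ∩ V₁ m n ∣ ≡ 2 → ∣ e ∩ V₂ m n ∣ ≡ 1 → m ≡ 3 + m′ → n ≡ 2 + n′ → ∀ t →
  det ℤ.+-*-rawRing (λ i j → RawClassMatrix.onDiagonal ℤ.+-*-rawRing i j t - seidel (completeBipartite³ m n ∖ᵉ e) i j) ≡
  (t - (+ 2 * + n - + 1)) ℤ.^ m′ * ((t - (+ 2 * + m - + 1)) ℤ.^ n′ * ℤ.- horner t (ξ₂ (+ m) (+ n)))
det-seidel {m} {n} (p , q , refl) ∣e∩V₁∣≡2 ∣e∩V₂∣≡1 =
  det-char {m} {n} p q (≡.trans (≡.sym (∣∩V₁∣ p q)) ∣e∩V₁∣≡2) (≡.trans (≡.sym (∣∩V₂∣ p q)) ∣e∩V₂∣≡1)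

theorem2p8 :
    ∀ {c ℓ} (K : CommutativeRing c ℓ) → IsFieldOfCharZero K →
    (m n : ℕ) → 3 ≤ m → 2 ≤ n →
    (e : Subset (m + n)) → IsEdge (completeBipartite³ m n) e →
    ∣ e ∩ V₁ m n ∣ ≡ 2 → ∣ e ∩ V₂ m n ∣ ≡ 1 →
    (spectrum : List (CommutativeRing.Carrier K)) →
    IsSeidelSpectrum K (completeBipartite³ m n ∖ᵉ e) spectrum ⇔
    (∃ λ (τ : Vec (CommutativeRing.Carrier K) 5) →
      IsRootsOf K (ξ₂ (+ m) (+ n)) (toList τ) ×
      _↭_ (CommutativeRing.setoid K) spectrum
        (replicate (m ∸ 3) (fromℤ K (+ 2 * + n - + 1)) ++
         replicate (n ∸ 2) (fromℤ K (+ 2 * + m - + 1)) ++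
         toList τ))
theorem2p8 K isField m n 3≤m 2≤n e _ ∣e∩V₁∣≡2 ∣e∩V₂∣≡1 =
  SeidelSpectrum.spectrum-split K isField (completeBipartite³ m n ∖ᵉ e)
    (+ 2 * + n - + 1) (+ 2 * + m - + 1) (m ∸ 3) (n ∸ 2) (ξ₂ (+ m) (+ n))
    (SeidelSpectrum.quintic-roots K isField (ξ₂ (+ m) (+ n)) (CommutativeRing.refl K)
      -- An index above five runs past the six coefficients, where `coeff` computes to zero.
      λ { (s≤s (s≤s (s≤s (s≤s (s≤s (s≤s _)))))) → CommutativeRing.refl K })
    -- The bounds on `m` and `n` make the subtractions exact and leave at least one vertex off `e`
    -- in each part, as merging requires.
    (det-seidel {m} {n} (Vec.splitAt m e) ∣e∩V₁∣≡2 ∣e∩V₂∣≡1 (≡.sym (ℕₚ.m+[n∸m]≡n 3≤m)) (≡.sym (ℕₚ.m+[n∸m]≡n 2≤n)))
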